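{- Let $n,k$ be integers with $n>2$ and $1<k<n$, and let $s=\left\lfloor \frac{n-2}{k-1}\right\rfloor$. Then the clique number of the $1$-skeleton of $DCMST_{n,k}$ satisfies $$\omega(DCMST_{n,k}) \geq 2^{\left(\sqrt{\left\lfloor \frac{s-1}{2}\right\rfloor} - 9\right)/2}.$$
   Context: Let $K_n=(V,E)$ be the complete graph on $n$ vertices, $d=n(n-1)/2$, and identify the coordinates of $\mathbb{R}^d$ with the edges of $K_n$. For a subgraph $t$ of $K_n$, its characteristic vector $x(t)\in\{0,1\}^d$ has coordinate $1$ exactly at the edges of $t$. The polytope $DCMST_{n,k}$ is the convex hull of the characteristic vectors of all spanning trees of $K_n$ in which no vertex has degree larger than $k$. The $1$-skeleton of a polytope is the graph whose vertices are the polytope's vertices and whose edges are its $1$-dimensional faces; the clique number $\omega$ is the maximum size of a set of pairwise adjacent vertices. -}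

module Defs where

open import Data.Nat as ℕ using (ℕ; zero; suc; _+_; _*_; _∸_; _^_; _/_; >-nonZero)
open import Data.Nat.Properties using (m<n⇒0<n∸m)
open import Data.Integer as ℤ using (ℤ; +_)
open import Data.Fin as Fin using (Fin)
open import Data.Fin.Properties using (_<?_)
open import Data.Bool using (Bool; true; false; _∧_; if_then_else_)
open import Data.List using (List; []; _∷_; _++_; [_]; length)
open import Data.List.Relation.Unary.Linked using (Linked)
open import Data.List.Relation.Unary.Unique.Propositional using (Unique)
open import Data.Product using (Σ; _×_; ∃)
open import Data.Sum using (_⊎_)
open import Relation.Nullary using (¬_; does)
open import Relation.Binary.PropositionalEquality using (_≡_; _≢_)

sumℤ : (n : ℕ) → (Fin n → ℤ) → ℤ
sumℤ zero    f = + 0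
sumℤ (suc n) f = f Fin.zero ℤ.+ sumℤ n (λ i → f (Fin.suc i))

sumℕ : (n : ℕ) → (Fin n → ℕ) → ℕ
sumℕ zero    f = 0
sumℕ (suc n) f = f Fin.zero + sumℕ n (λ i → f (Fin.suc i))

-- Subgraphs of K_n.  An edge of K_n is a pair (i , j) of vertices with
-- i < j; a subgraph (edge set) t is given by t i j for i < j (values of
-- t i j with i ≥ j are ignored).
Graph : ℕ → Set
Graph n = Fin n → Fin n → Bool

HasEdge : ∀ {n} → Graph n → Fin n → Fin n → Set
HasEdge t u v = (u Fin.< v × t u v ≡ true) ⊎ (v Fin.< u × t v u ≡ true)

charVec : ∀ {n} → Graph n → Fin n → Fin n → ℤ
charVec t i j = if does (i <? j) ∧ t i j then + 1 else + 0

SameVec : ∀ {n} → Graph n → Graph n → Set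
SameVec t t′ = ∀ i j → i Fin.< j → t i j ≡ t′ i j

-- inner product  c · x(t)  over the d = n(n-1)/2 edge coordinates
-- (a linear functional on ℝ^d is given by its values c i j on edges i < j)
dot : ∀ {n} → (Fin n → Fin n → ℤ) → Graph n → ℤ
dot {n} c t = sumℤ n (λ i → sumℤ n (λ j →
  if does (i <? j) then c i j ℤ.* charVec t i j else + 0))

degree : ∀ {n} → Graph n → Fin n → ℕ
degree {n} t v = sumℕ n (λ u →
  if (does (u <? v) ∧ t u v) then 1 else (if (does (v <? u) ∧ t v u) then 1 else 0))

data Walk {n} (t : Graph n) : Fin n → Fin n → Set where
  here : ∀ {u} → Walk t u u
  step : ∀ {u w v} → HasEdge t u w → Walk t w v → Walk t u v

Connected : ∀ {n} → Graph n → Set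
Connected {n} t = (u v : Fin n) → Walk t u v

IsCycle : ∀ {n} → Graph n → Fin n → List (Fin n) → Set
IsCycle t v₀ vs =
  2 ℕ.≤ length vs × Unique (v₀ ∷ vs) × Linked (HasEdge t) (v₀ ∷ vs ++ [ v₀ ])

HasCycle : ∀ {n} → Graph n → Set
HasCycle {n} t = Σ (Fin n) λ v₀ → Σ (List (Fin n)) λ vs → IsCycle t v₀ vs

IsSpanningTree : ∀ {n} → Graph n → Set
IsSpanningTree t = Connected t × ¬ HasCycle t

IsDCTree : ∀ {n} → ℕ → Graph n → Set
IsDCTree {n} k t = IsSpanningTree t × ((v : Fin n) → degree t v ℕ.≤ k)

-- Adjacency in the 1-skeleton of DCMST_{n,k} = conv{ x(t) : IsDCTree k t }:
-- x(t₁), x(t₂) are distinct and  conv{x(t₁),x(t₂)}  is a face, i.e. there is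
-- a linear functional c maximised over the polytope exactly on that segment:
-- c·x(t₁) = c·x(t₂) ≥ c·x(z) for every vertex x(z), with equality only when
-- x(z) ∈ {x(t₁), x(t₂)}.  (c may be taken integral since the polytope is
-- rational.)
Adjacent : ∀ {n} → ℕ → Graph n → Graph n → Set
Adjacent {n} k t₁ t₂ =
  ¬ SameVec t₁ t₂ ×
  Σ (Fin n → Fin n → ℤ) λ c →
    dot c t₁ ≡ dot c t₂ ×
    ((z : Graph n) → IsDCTree k z →
       (dot c z ℤ.≤ dot c t₁) ×
       (dot c z ≡ dot c t₁ → SameVec z t₁ ⊎ SameVec z t₂))

IsClique : ∀ {n} → ℕ → (m : ℕ) → (Fin m → Graph n) → Set
IsClique k m T =
  ((i : Fin m) → IsDCTree k (T i)) ×
  ((i j : Fin m) → i ≢ j → Adjacent k (T i) (T j))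

-- "m ≥ 2^((√a − 9)/2)" for a natural number m, expressed with integers:
-- m ≥ 1, and for every nonnegative rational p/q < √a − 9
-- (i.e. (p + 9q)² < a q²) we have 2^p ≤ m^(2q)  (i.e. 2^(p/q) ≤ m²).
AtLeastBound : ℕ → ℕ → Set
AtLeastBound m a =
  1 ℕ.≤ m ×
  ((p q : ℕ) → 1 ℕ.≤ q → (p + 9 * q) ^ 2 ℕ.< a * q ^ 2 → 2 ^ p ℕ.≤ m ^ (2 * q))

sVal : (n k : ℕ) → 1 ℕ.< k → ℕ
sVal n k hk = _/_ (n ∸ 2) (k ∸ 1) {{>-nonZero (m<n⇒0<n∸m hk)}}

{-# OPTIONS --safe #-}
-- The tree of a bit string X consists of a Hamiltonian path on a set of N "spine" vertices, of k - 2 pendant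
-- leaves at every spine vertex, and of one further path; only the spine path depends on X. Two trees are adjacent
-- as soon as no third admissible tree lies between their intersection and their union.
--
-- Every spine vertex has one edge common to all paths and one edge that depends on X. For each bit i there are
-- two tracks, "row i" and "column i", and each track is an alternating cycle whose mode (inner or outer) shows the
-- bit. For j ≤ i, row i and column j meet in a cell. There a strand of the path passes three switches, set by the
-- row, by the column and by a third, local mode, and a wrong parity of the three modes closes off a circuit.
-- A tree between the trees of X and Y therefore has the parity X i + X j = Y i + Y j of its row and column modes
-- in every cell whose bits both differ, so its differing bits all come from X or all from Y. A cell costs 16
-- vertices, whence about 8r² vertices for 2^r pairwise adjacent trees.
module Submission where

open import Defs
open import Data.Nat using (ℕ; _<_; _∸_; _/_)
open import Data.Fin using (Fin)
open import Data.Product using (Σ; _×_)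

open import Data.Nat as ℕ using
  (zero; suc; _+_; _*_; _^_; _%_; _⊔_; _≤_; z≤n; s≤s; _≡ᵇ_; _<ᵇ_; NonZero)
import Data.Nat.Properties as ℕ
open import Data.Nat.DivMod using
  (m%n<n; m≡m%n+[m/n]*n; [m+kn]%n≡m%n; m<n⇒m%n≡m; m<n*o⇒m/o<n; m≥n⇒m/n>0; m/n*n≤m)
open import Data.Nat.Induction using (<-wellFounded)
open import Data.Nat.Tactic.RingSolver using (solve-∀)
open import Data.Integer as ℤ using (ℤ; +_; -[1+_])
import Data.Integer.Properties as ℤ
open import Algebra.Properties.AbelianGroup ℤ.+-0-abelianGroup using (∙-cancelˡ)
open import Algebra.Properties.CommutativeSemigroup ℕ.+-commutativeSemigroup using (interchange)
open import Data.Fin as Fin using (toℕ; fromℕ<; combine; finToFun; funToFin)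
open import Data.Fin.Properties as Fin using
  (_<?_; toℕ-injective; toℕ-fromℕ<; fromℕ<-toℕ; toℕ<n; ¬∀⟶∃¬; funToFin-finToFin)
open import Data.Bool using (Bool; true; false; T; _∧_; _∨_; _xor_; not; if_then_else_)
import Data.Bool.Properties as Bool
open import Data.List using (List; []; _∷_; _++_; [_]; length; map; upTo; tabulate)
open import Data.List.Properties using (length-++; length-map; length-upTo; length-tabulate)
open import Data.List.Membership.Propositional using (_∈_)
open import Data.List.Membership.Propositional.Properties using (∈-++⁺ˡ; ∈-++⁺ʳ; ∈-map⁺; ∈-upTo⁺)
open import Data.List.Relation.Unary.All as All using (All; []; _∷_)
import Data.List.Relation.Unary.All.Properties as All
open import Data.List.Relation.Unary.AllPairs using ([]; _∷_)
open import Data.List.Relation.Unary.Any using () renaming (here to head; there to tail)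
open import Data.List.Relation.Unary.Linked using (Linked; _∷_)
open import Data.List.Relation.Unary.Unique.Propositional using (Unique)
import Data.List.Relation.Unary.Unique.Propositional.Properties as Unique
open import Data.Product using (_,_; proj₁; proj₂; ∃)
open import Data.Sum as ⊎ using (_⊎_; inj₁; inj₂; [_,_]′; swap)
open import Data.Empty using (⊥; ⊥-elim)
open import Data.Unit using (tt)
open import Function using (_∘_; case_of_; mk⇔)
open import Induction.WellFounded using (Acc; acc)
open import Relation.Nullary using (¬_; Dec; does; yes; no)
open import Relation.Nullary.Decidable using (dec-true; dec-false; does-⇔; _×-dec_; _⊎-dec_)
open import Relation.Binary.Construct.Closure.ReflexiveTransitive using (Star; ε; _◅_)
open import Relation.Binary.Definitions using (tri<; tri≈; tri>)
open import Relation.Binary.PropositionalEquality using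
  (_≡_; _≢_; refl; sym; trans; cong; cong₂; subst; subst₂; ≢-sym)

-- Adjacency of two trees

-- The obstacle is a graph that follows X on some tracks and Y on others. A cell excludes such
-- mixtures as follows. The number of inner modes among the three decides whether the strand meets
-- `c₂` or the exit `c₄` first: if it is even, both lanes are traversed; if it is odd, the strand
-- leaves early and the other lane closes up through `c₂` - `a₄`. If bits i and j both differ, then
-- X i + X j = Y i + Y j, so the local switch is common to both trees and the row and the column can
-- only change together. A cell thus compares two different tracks, whence a row and a column for
-- every bit; the diagonal cell ties these two to each other. Cells with j ≤ i suffice to compare
-- all bits. They cost about 16 · R² / 2 = 8R² vertices for R bits, which is what an exponent near
-- √(s/2) / 2 demands; the 9 absorbs the terms linear in R.

sumℤ-mono : ∀ n {f g : Fin n → ℤ} → (∀ i → f i ℤ.≤ g i) → sumℤ n f ℤ.≤ sumℤ n g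
sumℤ-mono zero    f≤g = ℤ.≤-refl
sumℤ-mono (suc n) f≤g = ℤ.+-mono-≤ (f≤g Fin.zero) (sumℤ-mono n (λ i → f≤g (Fin.suc i)))

sumℤ-cong : ∀ n {f g : Fin n → ℤ} → (∀ i → f i ≡ g i) → sumℤ n f ≡ sumℤ n g
sumℤ-cong zero    f≡g = refl
sumℤ-cong (suc n) f≡g = cong₂ ℤ._+_ (f≡g Fin.zero) (sumℤ-cong n (λ i → f≡g (Fin.suc i)))

+-tight : ∀ {a b c d} → a ℤ.≤ b → c ℤ.≤ d → a ℤ.+ c ≡ b ℤ.+ d → a ≡ b × c ≡ d
+-tight {a} {b} {c} {d} a≤b c≤d eq with a ℤ.≟ b
... | yes refl = refl , ∙-cancelˡ a c d eq
... | no a≢b = ⊥-elim (ℤ.<-irrefl eq (ℤ.+-mono-<-≤ (ℤ.≤∧≢⇒< a≤b a≢b) c≤d))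

-- The equality case of `sumℤ-mono`. Applied to rows and then to entries, it turns maximality of the
-- functional into a condition on each single edge.
sumℤ-tight : ∀ n {f g : Fin n → ℤ} → (∀ i → f i ℤ.≤ g i) → sumℤ n f ≡ sumℤ n g → ∀ i → f i ≡ g i
sumℤ-tight (suc n) f≤g eq i with +-tight (f≤g Fin.zero) (sumℤ-mono n (λ i → f≤g (Fin.suc i))) eq
sumℤ-tight (suc n) f≤g eq Fin.zero    | p , q = p
sumℤ-tight (suc n) f≤g eq (Fin.suc i) | p , q = sumℤ-tight n (λ i → f≤g (Fin.suc i)) q i

weight : Bool → Bool → ℤ
weight true  true  = + 1
weight false false = -[1+ 0 ]
weight _     _     = + 0

-- The summand of `dot c z` at one coordinate, `g` being the guard i < j. It unfolds to the same
-- expression, so statements about `dot` become case distinctions on Booleans.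
term : Bool → Bool → Bool → Bool → ℤ
term g a b z = if g then weight a b ℤ.* (if g ∧ z then + 1 else + 0) else + 0

term-≤ : ∀ g a b z → term g a b z ℤ.≤ term g a b a
term-≤ false a     b     z     = ℤ.≤-refl
term-≤ true  false false false = ℤ.≤-refl
term-≤ true  false false true  = ℤ.-≤+
term-≤ true  false true  z     = ℤ.≤-refl
term-≤ true  true  false z     = ℤ.≤-refl
term-≤ true  true  true  false = ℤ.+≤+ ℕ.z≤n
term-≤ true  true  true  true  = ℤ.≤-refl

term-≡ : ∀ g a b → term g a b a ≡ term g a b b
term-≡ false a     b     = refl
term-≡ true  false false = refl
term-≡ true  false true  = refl
term-≡ true  true  false = refl
term-≡ true  true  true  = refl

term-tight : ∀ a b z → term true a b z ≡ term true a b a →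
  (a ≡ true → b ≡ true → z ≡ true) × (z ≡ true → a ≡ true ⊎ b ≡ true)
term-tight false false false eq = (λ ()) , λ ()
term-tight false true  z     eq = (λ ()) , λ _ → inj₂ refl
term-tight true  b     true  eq = (λ _ _ → refl) , λ _ → inj₁ refl
term-tight true  false false eq = (λ _ ()) , λ ()

Between : ∀ {n} → Graph n → Graph n → Graph n → Set
Between t₁ t₂ z = ∀ i j → i Fin.< j →
  (t₁ i j ≡ true → t₂ i j ≡ true → z i j ≡ true) × (z i j ≡ true → t₁ i j ≡ true ⊎ t₂ i j ≡ true)

-- The functional is 1 on the common edges, 0 on the symmetric difference and −1 on all other edges.
between⇒adjacent : ∀ {n} k (t₁ t₂ : Graph n) → ¬ SameVec t₁ t₂ →
  (∀ z → IsDCTree k z → Between t₁ t₂ z → SameVec z t₁ ⊎ SameVec z t₂) →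
  Adjacent k t₁ t₂
between⇒adjacent {n} k t₁ t₂ t₁≢t₂ only =
  t₁≢t₂ , c
  , sumℤ-cong n (λ i → sumℤ-cong n (λ j → term-≡ (does (i <? j)) (t₁ i j) (t₂ i j)))
  , λ z tree → sumℤ-mono n (rows z) , λ eq → only z tree (tight z eq)
  where
  c : Fin n → Fin n → ℤ
  c i j = weight (t₁ i j) (t₂ i j)
  cells : ∀ z i j → term (does (i <? j)) (t₁ i j) (t₂ i j) (z i j) ℤ.≤ term (does (i <? j)) (t₁ i j) (t₂ i j) (t₁ i j)
  cells z i j = term-≤ (does (i <? j)) (t₁ i j) (t₂ i j) (z i j)
  rows : ∀ z i → _ ℤ.≤ _
  rows z i = sumℤ-mono n (cells z i)
  tight : ∀ z → dot c z ≡ dot c t₁ → Between t₁ t₂ z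
  tight z eq i j i<j = term-tight (t₁ i j) (t₂ i j) (z i j)
    (subst (λ g → term g (t₁ i j) (t₂ i j) (z i j) ≡ term g (t₁ i j) (t₂ i j) (t₁ i j))
      (dec-true (i <? j) i<j)
      (sumℤ-tight n (cells z i) (sumℤ-tight n (rows z) eq i) j))

-- Degrees and trees

HasEdge-sym : ∀ {n} (t : Graph n) {u v} → HasEdge t u v → HasEdge t v u
HasEdge-sym t = swap

hasEdge? : ∀ {n} (t : Graph n) u v → Dec (HasEdge t u v)
hasEdge? t u v = ((u <? v) ×-dec (t u v Bool.≟ true)) ⊎-dec ((v <? u) ×-dec (t v u Bool.≟ true))

-- The summand of `degree`, so that `degree t v` is `sumℕ n (incidence t v)` by definition.
incidence : ∀ {n} → Graph n → Fin n → Fin n → ℕ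
incidence t v u = if does (u <? v) ∧ t u v then 1 else (if does (v <? u) ∧ t v u then 1 else 0)

incidence-edge : ∀ {n} (t : Graph n) v u → HasEdge t v u → incidence t v u ≡ 1
incidence-edge t v u (inj₂ (u<v , e)) rewrite dec-true (u <? v) u<v | e = refl
incidence-edge t v u (inj₁ (v<u , e)) rewrite dec-true (v <? u) v<u | e with does (u <? v) ∧ t u v
... | true = refl
... | false = refl

incidence-≤1 : ∀ {n} (t : Graph n) v u → incidence t v u ≤ 1
incidence-≤1 t v u with does (u <? v) ∧ t u v | does (v <? u) ∧ t v u
... | true | _ = ℕ.≤-refl
... | false | true = ℕ.≤-refl
... | false | false = z≤n

guard-false : ∀ {P : Set} (d : Dec P) b → ¬ (P × b ≡ true) → does d ∧ b ≡ false
guard-false (yes p) true  ¬pb = ⊥-elim (¬pb (p , refl))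
guard-false (yes p) false ¬pb = refl
guard-false (no _)  b     ¬pb = refl

incidence-nonedge : ∀ {n} (t : Graph n) v u → ¬ HasEdge t v u → incidence t v u ≡ 0
incidence-nonedge t v u ¬e
  rewrite guard-false (u <? v) (t u v) (λ e → ¬e (inj₂ e))
        | guard-false (v <? u) (t v u) (λ e → ¬e (inj₁ e)) = refl

sumℕ-mono : ∀ n {f g : Fin n → ℕ} → (∀ i → f i ≤ g i) → sumℕ n f ≤ sumℕ n g
sumℕ-mono zero    f≤g = z≤n
sumℕ-mono (suc n) f≤g = ℕ.+-mono-≤ (f≤g Fin.zero) (sumℕ-mono n (λ i → f≤g (Fin.suc i)))

sumℕ-+ : ∀ n (f g : Fin n → ℕ) → sumℕ n (λ i → f i + g i) ≡ sumℕ n f + sumℕ n g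
sumℕ-+ zero    f g = refl
sumℕ-+ (suc n) f g rewrite sumℕ-+ n (λ i → f (Fin.suc i)) (λ i → g (Fin.suc i)) =
  interchange (f Fin.zero) (g Fin.zero) _ _

sumℕ-0 : ∀ n → sumℕ n (λ _ → 0) ≡ 0
sumℕ-0 zero = refl
sumℕ-0 (suc n) = sumℕ-0 n

δ : ∀ {n} → ℕ → Fin n → ℕ
δ l u = if toℕ u ≡ᵇ l then 1 else 0

sumℕ-δ-≤ : ∀ n l → sumℕ n (δ l) ≤ 1
sumℕ-δ-≤ zero    l       = z≤n
sumℕ-δ-≤ (suc n) zero    rewrite sumℕ-0 n = ℕ.≤-refl
sumℕ-δ-≤ (suc n) (suc l) = sumℕ-δ-≤ n l

sumℕ-δ : ∀ {n} (w : Fin n) → sumℕ n (δ (toℕ w)) ≡ 1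
sumℕ-δ {suc n} Fin.zero    rewrite sumℕ-0 n = refl
sumℕ-δ {suc n} (Fin.suc w) = sumℕ-δ w

δ-refl : ∀ {n} (u : Fin n) → δ (toℕ u) u ≡ 1
δ-refl u rewrite dec-true (toℕ u ℕ.≟ toℕ u) refl = refl

δ-≢ : ∀ {n} l (u : Fin n) → toℕ u ≢ l → δ l u ≡ 0
δ-≢ l u u≢l rewrite dec-false (toℕ u ℕ.≟ l) u≢l = refl

-- Mediates between degrees, which are sums over all vertices, and lists of neighbours. Its sum over
-- the vertices is the length of the list, or less if some labels are out of range; compared
-- pointwise with `incidence`, it bounds the degree from above or from below.
multiplicity : ∀ {n} → List ℕ → Fin n → ℕ
multiplicity []      u = 0
multiplicity (l ∷ L) u = δ l u + multiplicity L u

sumℕ-multiplicity-≤ : ∀ n L → sumℕ n (multiplicity L) ≤ length L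
sumℕ-multiplicity-≤ n []      = ℕ.≤-reflexive (sumℕ-0 n)
sumℕ-multiplicity-≤ n (l ∷ L) rewrite sumℕ-+ n (δ l) (multiplicity L) =
  ℕ.+-mono-≤ (sumℕ-δ-≤ n l) (sumℕ-multiplicity-≤ n L)

sumℕ-multiplicity : ∀ {n} (L : List (Fin n)) → sumℕ n (multiplicity (map toℕ L)) ≡ length L
sumℕ-multiplicity {n} []      = sumℕ-0 n
sumℕ-multiplicity {n} (w ∷ L) rewrite sumℕ-+ n (δ (toℕ w)) (multiplicity (map toℕ L)) =
  cong₂ _+_ (sumℕ-δ w) (sumℕ-multiplicity L)

∈⇒1≤multiplicity : ∀ {n} {L} (u : Fin n) → toℕ u ∈ L → 1 ≤ multiplicity L u
∈⇒1≤multiplicity u (head refl) rewrite δ-refl u = s≤s z≤n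
∈⇒1≤multiplicity {L = l ∷ L} u (tail u∈L) =
  ℕ.≤-trans (∈⇒1≤multiplicity u u∈L) (ℕ.m≤n+m (multiplicity L u) (δ l u))

∉⇒multiplicity≡0 : ∀ {n} {L : List (Fin n)} (u : Fin n) → All (u ≢_) L → multiplicity (map toℕ L) u ≡ 0
∉⇒multiplicity≡0 u []           = refl
∉⇒multiplicity≡0 {L = w ∷ L} u (u≢w ∷ u∉L)
  rewrite δ-≢ (toℕ w) u (λ eq → u≢w (toℕ-injective eq)) = ∉⇒multiplicity≡0 u u∉L

degree-≤-length : ∀ {n} (t : Graph n) v (L : List ℕ) → (∀ u → HasEdge t v u → toℕ u ∈ L) → degree t v ≤ length L
degree-≤-length {n} t v L nbrs =
  ℕ.≤-trans (sumℕ-mono n bound) (sumℕ-multiplicity-≤ n L)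
  where
  bound : ∀ u → incidence t v u ≤ multiplicity L u
  bound u with hasEdge? t v u
  ... | yes e = ℕ.≤-trans (incidence-≤1 t v u) (∈⇒1≤multiplicity u (nbrs u e))
  ... | no ¬e rewrite incidence-nonedge t v u ¬e = z≤n

length-≤-degree : ∀ {n} (t : Graph n) v {L : List (Fin n)} → Unique L → All (HasEdge t v) L → length L ≤ degree t v
length-≤-degree {n} t v {L} uniq nbrs =
  subst (_≤ degree t v) (sumℕ-multiplicity L) (sumℕ-mono n (bound uniq nbrs))
  where
  bound : ∀ {L} → Unique L → All (HasEdge t v) L → ∀ u → multiplicity (map toℕ L) u ≤ incidence t v u
  bound [] [] u = z≤n
  bound {w ∷ L} (w∉L ∷ uniq) (e ∷ nbrs) u with u Fin.≟ w
  ... | yes refl rewrite δ-refl u | ∉⇒multiplicity≡0 u w∉L = ℕ.≤-reflexive (sym (incidence-edge t v u e))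
  ... | no u≢w rewrite δ-≢ (toℕ w) u (λ eq → u≢w (toℕ-injective eq)) = bound uniq nbrs u

Walk-trans : ∀ {n} {t : Graph n} {u v w} → Walk t u v → Walk t v w → Walk t u w
Walk-trans here       q = q
Walk-trans (step e p) q = step e (Walk-trans p q)

Walk-sym : ∀ {n} {t : Graph n} {u v} → Walk t u v → Walk t v u
Walk-sym here       = here
Walk-sym {t = t} (step e p) = Walk-trans (Walk-sym p) (step (HasEdge-sym t e) here)

-- A certificate for a tree that is checked edge by edge: following the lower neighbours leads to
-- the root, and a cycle would have to peak at a vertex with two lower neighbours.
record Ranked {n} (t : Graph n) : Set where
  field
    rank     : Fin n → ℕ
    root     : Fin n
    distinct : ∀ {u v} → HasEdge t u v → rank u ≢ rank v
    unique   : ∀ {u v w} → HasEdge t u v → HasEdge t u w → rank v < rank u → rank w < rank u → v ≡ w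
    lower    : ∀ u → u ≡ root ⊎ ∃ λ v → HasEdge t u v × rank v < rank u

module _ {n} {t : Graph n} (R : Ranked t) where
  open Ranked R

  ranked⇒connected : Connected t
  ranked⇒connected u v = Walk-trans (descend u (<-wellFounded (rank u))) (Walk-sym (descend v (<-wellFounded (rank v))))
    where
    descend : ∀ u → Acc _<_ (rank u) → Walk t u root
    descend u (acc rs) with lower u
    ... | inj₁ refl = here
    ... | inj₂ (v , e , v<u) = step e (descend v (rs v<u))

  compare-edge : ∀ {u v} → HasEdge t u v → rank u < rank v ⊎ rank v < rank u
  compare-edge {u} {v} e with ℕ.<-cmp (rank u) (rank v)
  ... | tri< u<v _ _ = inj₁ u<v
  ... | tri≈ _ u≡v _ = ⊥-elim (distinct e u≡v)
  ... | tri> _ _ v<u = inj₂ v<u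

  -- Otherwise `a` and `c` would be two lower neighbours of `b`. Hence a walk without backtracking
  -- never descends again once it has risen.
  continue : ∀ {a b c} → HasEdge t a b → HasEdge t b c → a ≢ c → rank a < rank b → rank b < rank c
  continue e f a≢c a<b with compare-edge f
  ... | inj₁ b<c = b<c
  ... | inj₂ c<b = ⊥-elim (a≢c (unique (HasEdge-sym t e) f a<b c<b))

  module _ (v₀ : Fin n) where

    LastRises : List (Fin n) → Set
    LastRises vs = ∃ λ w → w ∈ vs × HasEdge t w v₀ × rank w < rank v₀

    climb : ∀ a b L → HasEdge t a b → Linked (HasEdge t) (b ∷ L ++ [ v₀ ]) →
      All (v₀ ≢_) (a ∷ b ∷ L) → Unique (a ∷ b ∷ L) → rank a < rank b → LastRises (b ∷ L) × rank a < rank v₀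
    climb a b [] e (f ∷ _) (v₀≢a ∷ _) _ a<b = (b , head refl , f , b<v₀) , ℕ.<-trans a<b b<v₀
      where b<v₀ = continue e f (≢-sym v₀≢a) a<b
    climb a b (c ∷ L) e (f ∷ link) (v₀≢a ∷ v₀∉) ((a≢b ∷ a≢c ∷ a∉) ∷ uniq) a<b
      with climb b c L f link v₀∉ uniq (continue e f a≢c a<b)
    ... | (w , w∈ , g , w<v₀) , b<v₀ = (w , tail w∈ , g , w<v₀) , ℕ.<-trans a<b b<v₀

    -- A walk back to `v₀` either descends all the way or turns upwards at some point and by
    -- `continue` still rises in its last step.
    fall : ∀ a b L → HasEdge t a b → Linked (HasEdge t) (b ∷ L ++ [ v₀ ]) →
      All (v₀ ≢_) (a ∷ b ∷ L) → Unique (a ∷ b ∷ L) → LastRises (b ∷ L) ⊎ rank v₀ < rank a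
    fall a b L e link v₀∉ uniq with compare-edge e
    ... | inj₁ a<b = inj₁ (proj₁ (climb a b L e link v₀∉ uniq a<b))
    fall a b [] e (f ∷ _) v₀∉ uniq | inj₂ b<a with compare-edge f
    ... | inj₁ b<v₀ = inj₁ (b , head refl , f , b<v₀)
    ... | inj₂ v₀<b = inj₂ (ℕ.<-trans v₀<b b<a)
    fall a b (c ∷ L) e (f ∷ link) (v₀≢a ∷ v₀∉) ((a≢b ∷ a≢c ∷ a∉) ∷ uniq) | inj₂ b<a
      with fall b c L f link v₀∉ uniq
    ... | inj₁ (w , w∈ , g , w<v₀) = inj₁ (w , tail w∈ , g , w<v₀)
    ... | inj₂ v₀<b = inj₂ (ℕ.<-trans v₀<b b<a)

  ranked⇒acyclic : ¬ HasCycle t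
  ranked⇒acyclic (v₀ , v₁ ∷ v₂ ∷ vs , _ , v₀∉@(v₀≢v₁ ∷ v₀≢v₂ ∷ _) ∷ uniq@((v₁≢v₂ ∷ v₁∉) ∷ _) , e ∷ f ∷ link)
    with compare-edge e
  ... | inj₁ v₀<v₁ = ℕ.<-asym v₀<v₁
          (proj₂ (climb v₀ v₁ v₂ vs f link v₀∉ uniq (continue e f v₀≢v₂ v₀<v₁)))
  ... | inj₂ v₁<v₀ with fall v₀ v₁ v₂ vs f link v₀∉ uniq
  ...   | inj₂ v₀<v₁ = ℕ.<-asym v₁<v₀ v₀<v₁
  -- Both neighbours of `v₀` on the cycle lie below it, so they coincide; but `v₁` does not recur
  -- among the later vertices.
  ...   | inj₁ (w , w∈ , g , w<v₀) = All.lookup (v₁≢v₂ ∷ v₁∉) w∈ (unique e (HasEdge-sym t g) v₁<v₀ w<v₀)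
  ranked⇒acyclic (v₀ , v₁ ∷ [] , s≤s () , _)

  ranked⇒tree : IsSpanningTree t
  ranked⇒tree = ranked⇒connected , ranked⇒acyclic

-- Pendant leaves

does-true : ∀ {P : Set} (P? : Dec P) → does P? ≡ true → P
does-true (yes p) _ = p
does-true (no _) ()

≡ᵇ-true : ∀ m n → m ≡ n → (m ≡ᵇ n) ≡ true
≡ᵇ-true m n = dec-true (m ℕ.≟ n)

true-≡ᵇ : ∀ m n → (m ≡ᵇ n) ≡ true → m ≡ n
true-≡ᵇ m n = does-true (m ℕ.≟ n)

if-yes : ∀ {A P : Set} (P? : Dec P) {x y : A} → P → (if does P? then x else y) ≡ x
if-yes P? p rewrite dec-true P? p = refl

if-no : ∀ {A P : Set} (P? : Dec P) {x y : A} → ¬ P → (if does P? then x else y) ≡ y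
if-no P? ¬p rewrite dec-false P? ¬p = refl

-- A relation on 0 … N-1 is extended to n vertices: each of the first N vertices gets k-2 pendant leaves,
-- namely its translates by N, …, (k-2)N, and the remaining vertices form a path starting at 0.
module Extend (N k′ n : ℕ) {{_ : NonZero N}} (N*K≤n : N * suc k′ ≤ n) where

  k : ℕ
  k = suc (suc k′)

  N*K : ℕ
  N*K = N * suc k′

  N≤N*K : N ≤ N*K
  N≤N*K = ℕ.m≤m*n N (suc k′)

  N≤n : N ≤ n
  N≤n = ℕ.≤-trans N≤N*K N*K≤n

  parent : ℕ → ℕ
  parent v = if v <ᵇ N*K then v % N else (if v ≡ᵇ N*K then 0 else ℕ.pred v)

  data ParentView (v : ℕ) : Set where
    leaf  : v < N*K → parent v ≡ v % N → ParentView v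
    first : v ≡ N*K → parent v ≡ 0 → ParentView v
    next  : N*K < v → suc (parent v) ≡ v → ParentView v

  parentView : ∀ v → ParentView v
  parentView v with v ℕ.<? N*K
  ... | yes v< = leaf v< (if-yes (v ℕ.<? N*K) v<)
  ... | no v≮ with v ℕ.≟ N*K
  ...   | yes v≡ = first v≡ (trans (if-no (v ℕ.<? N*K) v≮) (if-yes (v ℕ.≟ N*K) v≡))
  ...   | no v≢ = next N*K<v (trans (cong suc (trans (if-no (v ℕ.<? N*K) v≮) (if-no (v ℕ.≟ N*K) v≢)))
                       (ℕ.suc-pred v {{ℕ.>-nonZero (ℕ.≤-<-trans z≤n N*K<v)}}))
    where
    N*K<v : N*K < v
    N*K<v = ℕ.≤∧≢⇒< (ℕ.≮⇒≥ v≮) (≢-sym v≢)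

  parent< : ∀ v → N ≤ v → parent v < v
  parent< v N≤v with parentView v
  ... | leaf _ eq   = subst (_< v) (sym eq) (ℕ.<-≤-trans (m%n<n v N) N≤v)
  ... | first _ eq = subst (_< v) (sym eq) (ℕ.<-≤-trans (ℕ.>-nonZero⁻¹ N) N≤v)
  ... | next _ eq  = ℕ.≤-reflexive eq

  pendant : ℕ → ℕ → ℕ
  pendant u i = u + suc i * N

  N≤pendant : ∀ u i → N ≤ pendant u i
  N≤pendant u i = ℕ.≤-trans (ℕ.m≤m+n N (i * N)) (ℕ.m≤n+m (suc i * N) u)

  pendant<N*K : ∀ {u i} → u < N → i < k′ → pendant u i < N*K
  pendant<N*K {u} {i} u<N i<k′ = ℕ.<-≤-trans (ℕ.+-monoˡ-< (suc i * N) u<N)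
    (ℕ.≤-trans (ℕ.*-monoˡ-≤ N {suc (suc i)} {suc k′} (s≤s i<k′)) (ℕ.≤-reflexive (ℕ.*-comm (suc k′) N)))

  parent-pendant : ∀ {u i} → u < N → i < k′ → parent (pendant u i) ≡ u
  parent-pendant {u} {i} u<N i<k′ with parentView (pendant u i)
  ... | leaf _ eq = trans eq (trans ([m+kn]%n≡m%n u (suc i) N) (m<n⇒m%n≡m u<N))
  ... | first eq _ = ⊥-elim (ℕ.<-irrefl eq (pendant<N*K u<N i<k′))
  ... | next lt _ = ⊥-elim (ℕ.<-asym lt (pendant<N*K u<N i<k′))

  data ChildView (u v : ℕ) : Set where
    pend  : ∀ i → i < k′ → v ≡ pendant u i → ChildView u v
    chain : u ≡ 0 → v ≡ N*K → ChildView u v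

  childView : ∀ {u v} → u < N → N ≤ v → parent v ≡ u → ChildView u v
  childView {u} {v} u<N N≤v pv≡u with parentView v
  ... | first v≡ eq = chain (trans (sym pv≡u) eq) v≡
  ... | next lt eq  = ⊥-elim (ℕ.<-irrefl refl
          (ℕ.<-≤-trans lt (ℕ.≤-trans (ℕ.≤-reflexive (sym eq)) (subst (λ w → suc w ≤ N*K) (sym pv≡u) (ℕ.<-≤-trans u<N N≤N*K)))))
  ... | leaf v< eq = pend (ℕ.pred q) (ℕ.≤-pred q<K) (trans (m≡m%n+[m/n]*n v N)
          (cong₂ (λ a b → a + b * N) (trans (sym eq) pv≡u) (sym q≡)))
    where
    q = v / N
    q≡ : suc (ℕ.pred q) ≡ q
    q≡ = ℕ.suc-pred q {{ℕ.>-nonZero (m≥n⇒m/n>0 N≤v)}}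
    q<K : suc (suc (ℕ.pred q)) ≤ suc k′
    q<K = subst (λ w → suc w ≤ suc k′) (sym q≡) (m<n*o⇒m/o<n (subst (v <_) (ℕ.*-comm N (suc k′)) v<))

  child-next : ∀ {u v} → N ≤ u → parent v ≡ u → v ≡ suc u
  child-next {u} {v} N≤u pv≡u with parentView v
  ... | leaf _ eq  = ⊥-elim (ℕ.<⇒≱ (m%n<n v N) (subst (N ≤_) (trans (sym pv≡u) eq) N≤u))
  ... | first _ eq = ⊥-elim (ℕ.<⇒≱ (ℕ.>-nonZero⁻¹ N) (subst (N ≤_) (trans (sym pv≡u) eq) N≤u))
  ... | next _ eq  = trans (sym eq) (cong suc pv≡u)

  -- A graph is read only at u < v. There `v < N` puts both vertices on the spine, and any other `v`
  -- has its parent as its only smaller neighbour.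
  extend : (ℕ → ℕ → Bool) → Graph n
  extend A u v = if toℕ v <ᵇ N then A (toℕ u) (toℕ v) else (toℕ u ≡ᵇ parent (toℕ v))

  data Link (A : ℕ → ℕ → Bool) (u v : ℕ) : Set where
    bone : u < N → v < N → u ≢ v → A u v ≡ true → Link A u v
    up   : N ≤ u → parent u ≡ v → Link A u v
    down : N ≤ v → parent v ≡ u → Link A u v

  Symmetric : (ℕ → ℕ → Bool) → Set
  Symmetric A = ∀ {u v} → u < N → v < N → A u v ≡ A v u

  extend-bone : ∀ A {u v : Fin n} → toℕ v < N → extend A u v ≡ A (toℕ u) (toℕ v)
  extend-bone A {u} {v} v<N = if-yes (toℕ v ℕ.<? N) v<N

  extend-pendant : ∀ A {u v : Fin n} → N ≤ toℕ v → extend A u v ≡ (toℕ u ≡ᵇ parent (toℕ v))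
  extend-pendant A {u} {v} N≤v = if-no (toℕ v ℕ.<? N) (ℕ.≤⇒≯ N≤v)

  module _ (A : ℕ → ℕ → Bool) (A-sym : Symmetric A) where

    HasEdge⇒Link : ∀ {u v} → HasEdge (extend A) u v → Link A (toℕ u) (toℕ v)
    HasEdge⇒Link {u} {v} (inj₁ (u<v , e)) with toℕ v ℕ.<? N
    ... | yes v<N = bone (ℕ.<-trans u<v v<N) v<N (ℕ.<⇒≢ u<v) (trans (sym (extend-bone A {u} {v} v<N)) e)
    ... | no v≮N = down (ℕ.≮⇒≥ v≮N) (sym (true-≡ᵇ (toℕ u) _ (trans (sym (extend-pendant A {u} {v} (ℕ.≮⇒≥ v≮N))) e)))
    HasEdge⇒Link {u} {v} (inj₂ (v<u , e)) with toℕ u ℕ.<? N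
    ... | yes u<N = bone u<N (ℕ.<-trans v<u u<N) (≢-sym (ℕ.<⇒≢ v<u))
                      (trans (A-sym u<N (ℕ.<-trans v<u u<N)) (trans (sym (extend-bone A {v} {u} u<N)) e))
    ... | no u≮N = up (ℕ.≮⇒≥ u≮N) (sym (true-≡ᵇ (toℕ v) _ (trans (sym (extend-pendant A {v} {u} (ℕ.≮⇒≥ u≮N))) e)))

    Link⇒HasEdge : ∀ {u v} → Link A (toℕ u) (toℕ v) → HasEdge (extend A) u v
    Link⇒HasEdge {u} {v} (up N≤u eq) = inj₂ (subst (_< toℕ u) eq (parent< _ N≤u)
      , trans (extend-pendant A {v} {u} N≤u) (≡ᵇ-true (toℕ v) _ (sym eq)))
    Link⇒HasEdge {u} {v} (down N≤v eq) = inj₁ (subst (_< toℕ v) eq (parent< _ N≤v)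
      , trans (extend-pendant A {u} {v} N≤v) (≡ᵇ-true (toℕ u) _ (sym eq)))
    Link⇒HasEdge {u} {v} (bone u<N v<N u≢v a) with ℕ.<-cmp (toℕ u) (toℕ v)
    ... | tri< u<v _ _ = inj₁ (u<v , trans (extend-bone A {u} {v} v<N) a)
    ... | tri≈ _ u≡v _ = ⊥-elim (u≢v u≡v)
    ... | tri> _ _ v<u = inj₂ (v<u , trans (extend-bone A {v} {u} u<N) (trans (A-sym v<N u<N) a))

  0<n : 0 < n
  0<n = ℕ.<-≤-trans (ℕ.>-nonZero⁻¹ N) N≤n

  vertex : ℕ → Fin n
  vertex u with u ℕ.<? n
  ... | yes u<n = fromℕ< u<n
  ... | no _    = fromℕ< 0<n

  toℕ-vertex : ∀ {u} → u < n → toℕ (vertex u) ≡ u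
  toℕ-vertex {u} u<n with u ℕ.<? n
  ... | yes p  = toℕ-fromℕ< p
  ... | no u≮n = ⊥-elim (u≮n u<n)

  vertex-toℕ : ∀ v → vertex (toℕ v) ≡ v
  vertex-toℕ v = toℕ-injective (toℕ-vertex (toℕ<n v))

  -- The conditions exclude `u ≡ v` because `A` may hold on the diagonal, as `adj` does at the two
  -- ends of its path. Vertex 0 may have only one spine neighbour: besides its k - 2 leaves it
  -- carries the further path.
  record Spine (A : ℕ → ℕ → Bool) : Set where
    field
      symmetric  : Symmetric A
      nbrs       : ℕ → List ℕ
      nbrs-all   : ∀ {u v} → u < N → v < N → u ≢ v → A u v ≡ true → v ∈ nbrs u
      nbrs-≤2    : ∀ u → length (nbrs u) ≤ 2
      nbrs₀-≤1   : length (nbrs 0) ≤ 1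
      rank       : ℕ → ℕ
      bound      : ℕ
      rank<bound : ∀ {u} → u < N → rank u < bound
      distinct   : ∀ {u v} → u < N → v < N → u ≢ v → A u v ≡ true → rank u ≢ rank v
      unique     : ∀ {u v w} → u < N → v < N → w < N → u ≢ v → u ≢ w → A u v ≡ true → A u w ≡ true →
                   rank v < rank u → rank w < rank u → v ≡ w
      lower      : ∀ {u} → u < N → u ≡ 0 ⊎ ∃ λ v → v < N × u ≢ v × A u v ≡ true × rank v < rank u

  module _ {A : ℕ → ℕ → Bool} (S : Spine A) where
    open Spine S

    neighbours : ℕ → List ℕ
    neighbours u with u ℕ.<? N
    ... | no _ = parent u ∷ suc u ∷ []
    ... | yes _ with u
    ...   | zero  = N*K ∷ nbrs 0 ++ map (pendant 0) (upTo k′)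
    ...   | suc w = nbrs (suc w) ++ map (pendant (suc w)) (upTo k′)

    length-pendants : ∀ (xs : List ℕ) u m → length xs ≤ m → length (xs ++ map (pendant u) (upTo k′)) ≤ m + k′
    length-pendants xs u m xs≤m rewrite length-++ xs {map (pendant u) (upTo k′)} | length-map (pendant u) (upTo k′) | length-upTo k′ =
      ℕ.+-monoˡ-≤ k′ xs≤m

    neighbours-≤k : ∀ u → length (neighbours u) ≤ k
    neighbours-≤k u with u ℕ.<? N
    ... | no _ = s≤s (s≤s z≤n)
    ... | yes _ with u
    ...   | zero  = s≤s (length-pendants (nbrs 0) 0 1 nbrs₀-≤1)
    ...   | suc w = length-pendants (nbrs (suc w)) (suc w) 2 (nbrs-≤2 (suc w))

    neighbours-all : ∀ {u v} → Link A u v → v ∈ neighbours u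
    neighbours-all {u} link with u ℕ.<? N
    neighbours-all {u} (bone u<N _ _ _) | no u≮N = ⊥-elim (u≮N u<N)
    neighbours-all {u} (up _ refl)      | no u≮N = head refl
    neighbours-all {u} (down _ pv≡u)    | no u≮N = tail (head (child-next (ℕ.≮⇒≥ u≮N) pv≡u))
    neighbours-all {u} link | yes u<N with u
    neighbours-all (up N≤u _) | yes u<N | _ = ⊥-elim (ℕ.<⇒≱ u<N N≤u)
    neighbours-all (bone _ v<N u≢v a) | yes u<N | zero  = tail (∈-++⁺ˡ (nbrs-all u<N v<N u≢v a))
    neighbours-all (bone _ v<N u≢v a) | yes u<N | suc w = ∈-++⁺ˡ (nbrs-all u<N v<N u≢v a)
    neighbours-all (down N≤v pv≡u) | yes u<N | zero with childView u<N N≤v pv≡u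
    ... | chain _ refl = head refl
    ... | pend i i<k′ refl = tail (∈-++⁺ʳ (nbrs 0) (∈-map⁺ (pendant 0) (∈-upTo⁺ i<k′)))
    neighbours-all (down N≤v pv≡u) | yes u<N | suc w with childView u<N N≤v pv≡u
    ... | chain () _
    ... | pend i i<k′ refl = ∈-++⁺ʳ (nbrs (suc w)) (∈-map⁺ (pendant (suc w)) (∈-upTo⁺ i<k′))

    -- Vertices off the spine rank above the whole spine and in the order of their labels, so that
    -- every one of them ranks above its parent.
    rank⁺ : ℕ → ℕ
    rank⁺ u = if u <ᵇ N then rank u else bound + u

    rank⁺-bone : ∀ {u} → u < N → rank⁺ u ≡ rank u
    rank⁺-bone {u} u<N = if-yes (u ℕ.<? N) u<N

    rank⁺-up : ∀ {u} → N ≤ u → rank⁺ u ≡ bound + u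
    rank⁺-up {u} N≤u = if-no (u ℕ.<? N) (ℕ.≤⇒≯ N≤u)

    rank⁺-parent : ∀ {u} → N ≤ u → rank⁺ (parent u) < rank⁺ u
    rank⁺-parent {u} N≤u with parent u ℕ.<? N
    ... | yes p<N = subst₂ _<_ (sym (rank⁺-bone p<N)) (sym (rank⁺-up N≤u)) (ℕ.<-≤-trans (rank<bound p<N) (ℕ.m≤m+n bound u))
    ... | no p≮N = subst₂ _<_ (sym (rank⁺-up (ℕ.≮⇒≥ p≮N))) (sym (rank⁺-up N≤u)) (ℕ.+-monoʳ-< bound (parent< u N≤u))

    Link-distinct : ∀ {u v} → Link A u v → rank⁺ u ≢ rank⁺ v
    Link-distinct (bone u<N v<N u≢v a) eq = distinct u<N v<N u≢v a (trans (sym (rank⁺-bone u<N)) (trans eq (rank⁺-bone v<N)))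
    Link-distinct (up N≤u refl) eq = ℕ.<-irrefl (sym eq) (rank⁺-parent N≤u)
    Link-distinct (down N≤v refl) eq = ℕ.<-irrefl eq (rank⁺-parent N≤v)

    Link-unique : ∀ {u v w} → Link A u v → Link A u w → rank⁺ v < rank⁺ u → rank⁺ w < rank⁺ u → v ≡ w
    Link-unique (up _ refl) (up _ refl) _ _ = refl
    Link-unique (down N≤v refl) _ v<u _ = ⊥-elim (ℕ.<-asym v<u (rank⁺-parent N≤v))
    Link-unique _ (down N≤w refl) _ w<u = ⊥-elim (ℕ.<-asym w<u (rank⁺-parent N≤w))
    Link-unique (bone u<N _ _ _) (up N≤u _) _ _ = ⊥-elim (ℕ.<⇒≱ u<N N≤u)
    Link-unique (up N≤u _) (bone u<N _ _ _) _ _ = ⊥-elim (ℕ.<⇒≱ u<N N≤u)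
    Link-unique (bone u<N v<N u≢v a) (bone _ w<N u≢w b) v<u w<u =
      unique u<N v<N w<N u≢v u≢w a b (subst₂ _<_ (rank⁺-bone v<N) (rank⁺-bone u<N) v<u)
        (subst₂ _<_ (rank⁺-bone w<N) (rank⁺-bone u<N) w<u)

    link-vertex : ∀ {u} {v : ℕ} → v < n → Link A (toℕ u) v → HasEdge (extend A) u (vertex v)
    link-vertex v<n l = Link⇒HasEdge A symmetric (subst (Link A _) (sym (toℕ-vertex v<n)) l)

    extend-ranked : Ranked (extend A)
    extend-ranked = record
      { rank     = λ u → rank⁺ (toℕ u)
      ; root     = fromℕ< 0<n
      ; distinct = λ e → Link-distinct (HasEdge⇒Link A symmetric e)
      ; unique   = λ e f v<u w<u → toℕ-injective
          (Link-unique (HasEdge⇒Link A symmetric e) (HasEdge⇒Link A symmetric f) v<u w<u)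
      ; lower    = lower⁺
      }
      where
      lower⁺ : ∀ u → u ≡ fromℕ< 0<n ⊎ ∃ λ v → HasEdge (extend A) u v × rank⁺ (toℕ v) < rank⁺ (toℕ u)
      lower⁺ u with toℕ u ℕ.<? N
      ... | no u≮N = inj₂ (vertex (parent (toℕ u)) , link-vertex p<n (up N≤u refl)
                          , subst (λ w → rank⁺ w < rank⁺ (toℕ u)) (sym (toℕ-vertex p<n)) (rank⁺-parent N≤u))
        where
        N≤u = ℕ.≮⇒≥ u≮N
        p<n : parent (toℕ u) < n
        p<n = ℕ.<-trans (parent< _ N≤u) (toℕ<n u)
      ... | yes u<N with lower u<N
      ...   | inj₁ u≡0 = inj₁ (toℕ-injective (trans u≡0 (sym (toℕ-fromℕ< 0<n))))
      ...   | inj₂ (v , v<N , u≢v , a , v<u) = inj₂ (vertex v , link-vertex v<n (bone u<N v<N u≢v a)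
                , subst (λ w → rank⁺ w < rank⁺ (toℕ u)) (sym (toℕ-vertex v<n))
                    (subst₂ _<_ (sym (rank⁺-bone v<N)) (sym (rank⁺-bone u<N)) v<u))
        where v<n = ℕ.<-≤-trans v<N N≤n

    extend-tree : IsDCTree k (extend A)
    extend-tree = ranked⇒tree extend-ranked , λ v →
      ℕ.≤-trans (degree-≤-length (extend A) v (neighbours (toℕ v))
                  (λ u e → neighbours-all (HasEdge⇒Link A symmetric e)))
                (neighbours-≤k (toℕ v))

  -- The trace of an intermediate tree on the spine

  Step : (ℕ → ℕ → Bool) → ℕ → ℕ → Set
  Step Z u v = u < N × v < N × Z u v ≡ true

  -- What is kept of an admissible tree between two extended spines. The connecting walks stay
  -- inside the spine, so the later argument takes place on N vertices and in maximum degree two.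
  record Trace (A B Z : ℕ → ℕ → Bool) : Set where
    field
      symmetric   : ∀ u v → Z u v ≡ Z v u
      irreflexive : ∀ u → Z u u ≡ false
      ⊇∩          : ∀ {u v} → u < N → v < N → u ≢ v → A u v ≡ true → B u v ≡ true → Z u v ≡ true
      ⊆∪          : ∀ {u v} → u < N → v < N → Z u v ≡ true → A u v ≡ true ⊎ B u v ≡ true
      degree≤2    : ∀ {u a b c} → u < N → a < N → b < N → c < N → a ≢ b → a ≢ c → b ≢ c →
                    Z u a ≡ true → Z u b ≡ true → Z u c ≡ true → ⊥
      connected   : ∀ {u v} → u < N → v < N → Star (Step Z) u v

  Agree : (A Z : ℕ → ℕ → Bool) → Set
  Agree A Z = ∀ {u v} → u < N → v < N → u ≢ v → Z u v ≡ A u v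

  data Ancestor : ℕ → ℕ → Set where
    base : ∀ {u} → u < N → Ancestor u u
    rise : ∀ {u v} → N ≤ v → Ancestor (parent v) u → Ancestor v u

  module _ {A B : ℕ → ℕ → Bool} (A-sym : Symmetric A) (B-sym : Symmetric B)
           (z : Graph n) (z-tree : IsDCTree k z) (btw : Between (extend A) (extend B) z) where

    trace : ℕ → ℕ → Bool
    trace u v = does (hasEdge? z (vertex u) (vertex v))

    trace⇒HasEdge : ∀ {u v} → trace u v ≡ true → HasEdge z (vertex u) (vertex v)
    trace⇒HasEdge {u} {v} = does-true (hasEdge? z (vertex u) (vertex v))

    HasEdge⇒trace : ∀ {u v} → HasEdge z (vertex u) (vertex v) → trace u v ≡ true
    HasEdge⇒trace {u} {v} = dec-true (hasEdge? z (vertex u) (vertex v))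

    common : ∀ {u v} → HasEdge (extend A) u v → HasEdge (extend B) u v → HasEdge z u v
    common (inj₁ (u<v , a)) (inj₁ (_ , b)) = inj₁ (u<v , proj₁ (btw _ _ u<v) a b)
    common (inj₂ (v<u , a)) (inj₂ (_ , b)) = inj₂ (v<u , proj₁ (btw _ _ v<u) a b)
    common (inj₁ (u<v , _)) (inj₂ (v<u , _)) = ⊥-elim (ℕ.<-asym u<v v<u)
    common (inj₂ (v<u , _)) (inj₁ (u<v , _)) = ⊥-elim (ℕ.<-asym u<v v<u)

    union : ∀ {u v} → HasEdge z u v → Link A (toℕ u) (toℕ v) ⊎ Link B (toℕ u) (toℕ v)
    union (inj₁ (u<v , e)) with proj₂ (btw _ _ u<v) e
    ... | inj₁ a = inj₁ (HasEdge⇒Link A A-sym (inj₁ (u<v , a)))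
    ... | inj₂ b = inj₂ (HasEdge⇒Link B B-sym (inj₁ (u<v , b)))
    union (inj₂ (v<u , e)) with proj₂ (btw _ _ v<u) e
    ... | inj₁ a = inj₁ (HasEdge⇒Link A A-sym (inj₂ (v<u , a)))
    ... | inj₂ b = inj₂ (HasEdge⇒Link B B-sym (inj₂ (v<u , b)))

    common-links : ∀ {u v} → Link A (toℕ u) (toℕ v) → Link B (toℕ u) (toℕ v) → HasEdge z u v
    common-links a b = common (Link⇒HasEdge A A-sym a) (Link⇒HasEdge B B-sym b)

    trace-step : ∀ {u v} → toℕ u < N → toℕ v < N → HasEdge z u v → Step trace (toℕ u) (toℕ v)
    trace-step u<N v<N e = u<N , v<N
      , HasEdge⇒trace (subst₂ (HasEdge z) (sym (vertex-toℕ _)) (sym (vertex-toℕ _)) e)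

    -- Each vertex is sent to the spine vertex reached by iterating `parent`. An edge off the spine
    -- joins a vertex to its parent and does not change this image, so a walk in `z` projects to a
    -- walk made of its spine edges only.
    project : ∀ {a b u w} → Walk z a b → Ancestor (toℕ a) u → Ancestor (toℕ b) w → Star (Step trace) u w
    project here p q = subst (Star (Step trace) _) (Ancestor-unique p q) ε
      where
      Ancestor-unique : ∀ {v u w} → Ancestor v u → Ancestor v w → u ≡ w
      Ancestor-unique (base _) (base _) = refl
      Ancestor-unique (base u<N) (rise N≤u _) = ⊥-elim (ℕ.<⇒≱ u<N N≤u)
      Ancestor-unique (rise N≤u _) (base u<N) = ⊥-elim (ℕ.<⇒≱ u<N N≤u)
      Ancestor-unique (rise _ p) (rise _ q) = Ancestor-unique p q
    project {a} {u = u} {w} (step {w = c} e walk) p q = [ (λ l → along l p) , (λ l → along l p) ]′ (union e)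
      where
      along : ∀ {C} → Link C (toℕ a) (toℕ c) → Ancestor (toℕ a) u → Star (Step trace) u w
      along (bone a<N c<N _ _) (base _)     = trace-step a<N c<N e ◅ project walk (base c<N) q
      along (bone a<N _ _ _)   (rise N≤a _) = ⊥-elim (ℕ.<⇒≱ a<N N≤a)
      along (up N≤a _)         (base a<N)   = ⊥-elim (ℕ.<⇒≱ a<N N≤a)
      along (up _ eq)          (rise _ p)   = project walk (subst (λ v → Ancestor v u) eq p) q
      along (down N≤c eq)      p            = project walk (rise N≤c (subst (λ v → Ancestor v u) (sym eq) p)) q

    at : ∀ {u} → u < N → toℕ (vertex u) ≡ u
    at u<N = toℕ-vertex (ℕ.<-≤-trans u<N N≤n)

    pendants : ∀ {u} → u < N → Fin k′ → Fin n
    pendants {u} u<N i = vertex (pendant u (toℕ i))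

    toℕ-pendants : ∀ {u} (u<N : u < N) i → toℕ (pendants u<N i) ≡ pendant u (toℕ i)
    toℕ-pendants u<N i = toℕ-vertex (ℕ.<-≤-trans (pendant<N*K u<N (toℕ<n i)) N*K≤n)

    pendants-injective : ∀ {u} (u<N : u < N) {i j} → pendants u<N i ≡ pendants u<N j → i ≡ j
    pendants-injective {u} u<N {i} {j} eq = toℕ-injective (ℕ.suc-injective (ℕ.*-cancelʳ-≡ _ _ N (ℕ.+-cancelˡ-≡ u _ _
      (trans (sym (toℕ-pendants u<N i)) (trans (cong toℕ eq) (toℕ-pendants u<N j))))))

    bone∉pendants : ∀ {u a} (u<N : u < N) → a < N → All (vertex a ≢_) (tabulate (pendants u<N))
    bone∉pendants {u} {a} u<N a<N = All.tabulate⁺ λ i eq → ℕ.<⇒≱ a<N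
      (subst (N ≤_) (trans (sym (toℕ-pendants u<N i)) (trans (cong toℕ (sym eq)) (at a<N))) (N≤pendant u (toℕ i)))

    pendants-adjacent : ∀ {u} (u<N : u < N) → All (HasEdge z (vertex u)) (tabulate (pendants u<N))
    pendants-adjacent {u} u<N = All.tabulate⁺ λ i → common-links (link i) (link i)
      where
      link : ∀ {C} i → Link C (toℕ (vertex u)) (toℕ (pendants u<N i))
      link i rewrite toℕ-pendants u<N i | at u<N = down (N≤pendant u (toℕ i)) (parent-pendant u<N (toℕ<n i))

    vertex-≢ : ∀ {a b} → a < N → b < N → a ≢ b → vertex a ≢ vertex b
    vertex-≢ a<N b<N a≢b eq = a≢b (trans (sym (at a<N)) (trans (cong toℕ eq) (at b<N)))

    -- The k-2 pendant edges at a vertex lie in z, so the degree bound leaves room for two more edges.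
    trace-degree≤2 : ∀ {u a b c} → u < N → a < N → b < N → c < N → a ≢ b → a ≢ c → b ≢ c →
      trace u a ≡ true → trace u b ≡ true → trace u c ≡ true → ⊥
    trace-degree≤2 {u} {a} {b} {c} u<N a<N b<N c<N a≢b a≢c b≢c ua ub uc =
      ℕ.<-irrefl refl (ℕ.<-≤-trans long (proj₂ z-tree (vertex u)))
      where
      L = vertex a ∷ vertex b ∷ vertex c ∷ tabulate (pendants u<N)
      uniq : Unique L
      uniq = (vertex-≢ a<N b<N a≢b ∷ vertex-≢ a<N c<N a≢c ∷ bone∉pendants u<N a<N)
           ∷ (vertex-≢ b<N c<N b≢c ∷ bone∉pendants u<N b<N)
           ∷ bone∉pendants u<N c<N
           ∷ Unique.tabulate⁺ (pendants-injective u<N)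
      long : k < degree z (vertex u)
      long = subst (λ m → suc (suc (suc m)) ≤ degree z (vertex u)) (length-tabulate (pendants u<N))
        (length-≤-degree z (vertex u) uniq
          (trace⇒HasEdge ua ∷ trace⇒HasEdge ub ∷ trace⇒HasEdge uc ∷ pendants-adjacent u<N))

    link-at : ∀ {C u v} → u < N → v < N → u ≢ v → C u v ≡ true → Link C (toℕ (vertex u)) (toℕ (vertex v))
    link-at u<N v<N u≢v c rewrite at u<N | at v<N = bone u<N v<N u≢v c

    isTrace : Trace A B trace
    isTrace = record
      { symmetric   = λ u v → does-⇔ (mk⇔ (HasEdge-sym z) (HasEdge-sym z)) (hasEdge? z (vertex u) (vertex v)) (hasEdge? z (vertex v) (vertex u))
      ; irreflexive = λ u → dec-false (hasEdge? z (vertex u) (vertex u))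
          λ { (inj₁ (u<u , _)) → ℕ.<-irrefl refl u<u ; (inj₂ (u<u , _)) → ℕ.<-irrefl refl u<u }
      ; ⊇∩          = λ u<N v<N u≢v a b → HasEdge⇒trace
          (common-links (link-at u<N v<N u≢v a) (link-at u<N v<N u≢v b))
      ; ⊆∪          = λ u<N v<N e → ⊎.map (unlink u<N v<N) (unlink u<N v<N) (union (trace⇒HasEdge e))
      ; degree≤2    = trace-degree≤2
      ; connected   = λ {u} {v} u<N v<N → project (proj₁ (proj₁ z-tree) (vertex u) (vertex v))
          (subst (λ w → Ancestor w u) (sym (at u<N)) (base u<N)) (subst (λ w → Ancestor w v) (sym (at v<N)) (base v<N))
      }
      where
      unlink : ∀ {C u v} → u < N → v < N → Link C (toℕ (vertex u)) (toℕ (vertex v)) → C u v ≡ true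
      unlink u<N v<N l rewrite at u<N | at v<N with l
      ... | bone _ _ _ c = c
      ... | up N≤u _ = ⊥-elim (ℕ.<⇒≱ u<N N≤u)
      ... | down N≤v _ = ⊥-elim (ℕ.<⇒≱ v<N N≤v)

    agree⇒same : ∀ {C} → (∀ {i j} → N ≤ toℕ j → i Fin.< j → z i j ≡ extend C i j) → Agree C trace → SameVec z (extend C)
    agree⇒same {C} outside agree i j i<j with toℕ j ℕ.<? N
    ... | no j≮N = outside (ℕ.≮⇒≥ j≮N) i<j
    ... | yes j<N = trans (trans (sym same) (agree (ℕ.<-trans i<j j<N) j<N (ℕ.<⇒≢ i<j))) (sym (extend-bone C {i} {j} j<N))
      where
      same : trace (toℕ i) (toℕ j) ≡ z i j
      same rewrite vertex-toℕ i | vertex-toℕ j = value (hasEdge? z i j)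
        where
        value : (d : Dec (HasEdge z i j)) → does d ≡ z i j
        value (yes (inj₁ (_ , e)))   = sym e
        value (yes (inj₂ (j<i , _))) = ⊥-elim (ℕ.<-asym i<j j<i)
        value (no ¬e)                = sym (Bool.¬-not (λ e → ¬e (inj₁ (i<j , e))))

    -- Off the spine all extensions have the same edges, so being between two of them leaves `z` no
    -- choice.
    outside : ∀ {C i j} → N ≤ toℕ j → i Fin.< j → z i j ≡ extend C i j
    outside {C} {i} {j} N≤j i<j with proj₁ (btw i j i<j) | proj₂ (btw i j i<j)
    ... | lo | hi rewrite extend-pendant A {i} {j} N≤j | extend-pendant B {i} {j} N≤j | extend-pendant C {i} {j} N≤j
      with toℕ i ≡ᵇ parent (toℕ j) | z i j
    ... | true  | true  = refl
    ... | false | false = refl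
    ... | true  | false = lo refl refl
    ... | false | true  = case hi refl of λ { (inj₁ ()) ; (inj₂ ()) }

  extend-adjacent : ∀ {A B} → Symmetric A → Symmetric B →
    (∃ λ u → ∃ λ v → u < N × v < N × u ≢ v × A u v ≢ B u v) →
    (∀ Z → Trace A B Z → Agree A Z ⊎ Agree B Z) →
    Adjacent k (extend A) (extend B)
  extend-adjacent {A} {B} A-sym B-sym (u , v , u<N , v<N , u≢v , Auv≢Buv) only =
    between⇒adjacent k (extend A) (extend B) different λ z z-tree btw →
      ⊎.map (agree⇒same A-sym B-sym z z-tree btw {A} (outside A-sym B-sym z z-tree btw {A}))
            (agree⇒same A-sym B-sym z z-tree btw {B} (outside A-sym B-sym z z-tree btw {B}))
            (only _ (isTrace A-sym B-sym z z-tree btw))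
    where
    value : ∀ C {a b} → a < N → b < N → extend C (vertex a) (vertex b) ≡ C a b
    value C {a} {b} a<N b<N = trans (extend-bone C {vertex a} {vertex b} (subst (_< N) (sym (toℕ-vertex (ℕ.<-≤-trans b<N N≤n))) b<N))
      (cong₂ C (toℕ-vertex (ℕ.<-≤-trans a<N N≤n)) (toℕ-vertex (ℕ.<-≤-trans b<N N≤n)))
    transfer : ∀ {a b} → a < N → b < N → a < b → SameVec (extend A) (extend B) → A a b ≡ B a b
    transfer {a} {b} a<N b<N a<b same = trans (sym (value A a<N b<N)) (trans
      (same (vertex a) (vertex b) (subst₂ _<_ (sym (toℕ-vertex (ℕ.<-≤-trans a<N N≤n))) (sym (toℕ-vertex (ℕ.<-≤-trans b<N N≤n))) a<b))
      (value B a<N b<N))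
    different : ¬ SameVec (extend A) (extend B)
    different same with ℕ.<-cmp u v
    ... | tri< u<v _ _ = Auv≢Buv (transfer u<N v<N u<v same)
    ... | tri≈ _ u≡v _ = u≢v u≡v
    ... | tri> _ _ v<u = Auv≢Buv (trans (A-sym u<N v<N) (trans (transfer v<N u<N v<u same) (sym (B-sym u<N v<N))))

-- The spine

-- The ports aᵢ, bᵢ, cᵢ of a cell form the switches set by its row, its column and its local mode.
data Port : Set where
  a₁ a₂ a₃ a₄ a₅ a₆ b₁ b₂ b₃ b₄ b₅ b₆ c₁ c₂ c₃ c₄ : Port

-- Rows and columns are numbered from 0 to r. The last argument of rP, rQ and cell is r minus the row, that of cP
-- and cQ is r minus the column, and cell p j d e lies in row j + d and column j. With this redundant coordinate
-- the neighbour maps are plain pattern matches, which preserve the size r.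
data Node : Set where
  start end   : ℕ → Node
  rP rQ cP cQ : ℕ → ℕ → Node
  cell        : Port → ℕ → ℕ → ℕ → Node

size : Node → ℕ
size (start e)      = e
size (end i)        = i
size (rP i e)       = i + e
size (rQ i e)       = i + e
size (cP i e)       = i + e
size (cQ i e)       = i + e
size (cell _ j d e) = (j + d) + e

-- The edges v — fixed v belong to all spine paths; the remaining edge at v goes to inner v or to outer v.
fixed : Node → Node
fixed (start e)               = rP 0 e
fixed (end i)                 = cell c₄ i 0 0
fixed (rP zero e)             = start e
fixed (rP (suc i) e)          = cell c₄ i 0 (suc e)
fixed (rQ i e)                = cP i e
fixed (cP i e)                = rQ i e
fixed (cQ i e)                = cell a₂ 0 i e
fixed (cell a₂ zero d e)      = cQ d e
fixed (cell a₂ (suc j) d e)   = cell c₄ j (suc d) e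
fixed (cell c₄ j (suc d) e)   = cell a₂ (suc j) d e
fixed (cell c₄ j zero (suc e)) = rP (suc j) e
fixed (cell c₄ j zero zero)   = end j
fixed (cell a₁ j d e)         = cell a₆ j d e
fixed (cell a₆ j d e)         = cell a₁ j d e
fixed (cell a₃ j d e)         = cell b₂ j d e
fixed (cell b₂ j d e)         = cell a₃ j d e
fixed (cell a₅ j d e)         = cell b₄ j d e
fixed (cell b₄ j d e)         = cell a₅ j d e
fixed (cell b₁ j d e)         = cell b₆ j d e
fixed (cell b₆ j d e)         = cell b₁ j d e
fixed (cell b₃ j d e)         = cell c₁ j d e
fixed (cell c₁ j d e)         = cell b₃ j d e
fixed (cell b₅ j d e)         = cell c₃ j d e
fixed (cell c₃ j d e)         = cell b₅ j d e
fixed (cell c₂ j d e)         = cell a₄ j d e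
fixed (cell a₄ j d e)         = cell c₂ j d e

-- In its inner mode a row joins `a₃` to `a₄` and, through the fixed edge `a₁` - `a₆`, also `a₂` to
-- `a₅`; in its outer mode it joins `a₂` to `a₃` and `a₄` to `a₅`. Columns act likewise on `b₂` to
-- `b₅`. The ends are their own mates in either mode, which makes them the ends of the path.
inner : Node → Node
inner (start e)       = start e
inner (end i)         = end i
inner (rP i e)        = rQ i e
inner (rQ i e)        = rP i e
inner (cP i e)        = cQ i e
inner (cQ i e)        = cP i e
inner (cell a₁ j d e) = cell a₂ j d e
inner (cell a₂ j d e) = cell a₁ j d e
inner (cell a₃ j d e) = cell a₄ j d e
inner (cell a₄ j d e) = cell a₃ j d e
inner (cell a₅ j d e) = cell a₆ j d e
inner (cell a₆ j d e) = cell a₅ j d e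
inner (cell b₁ j d e) = cell b₂ j d e
inner (cell b₂ j d e) = cell b₁ j d e
inner (cell b₃ j d e) = cell b₄ j d e
inner (cell b₄ j d e) = cell b₃ j d e
inner (cell b₅ j d e) = cell b₆ j d e
inner (cell b₆ j d e) = cell b₅ j d e
inner (cell c₁ j d e) = cell c₄ j d e
inner (cell c₂ j d e) = cell c₃ j d e
inner (cell c₃ j d e) = cell c₂ j d e
inner (cell c₄ j d e) = cell c₁ j d e

-- The pairs `a₁` - `a₆` that the strands skip in outer mode are strung together here between `rP`
-- and `rQ`, and the pairs `b₁` - `b₆` between `cP` and `cQ`. A change of mode therefore leaves no
-- vertex off the path: in inner mode the strands collect the pairs and the caps are joined
-- directly.
outer : Node → Node
outer (start e)             = start e
outer (end i)               = end i
outer (rP i e)              = cell a₁ 0 i e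
outer (rQ i e)              = cell a₆ i 0 e
outer (cP j e)              = cell b₁ j 0 e
outer (cQ j d)              = cell b₆ j d 0
outer (cell a₁ zero d e)    = rP d e
outer (cell a₁ (suc j) d e) = cell a₆ j (suc d) e
outer (cell a₆ j zero e)    = rQ j e
outer (cell a₆ j (suc d) e) = cell a₁ (suc j) d e
outer (cell b₁ j zero e)    = cP j e
outer (cell b₁ j (suc d) e) = cell b₆ j d (suc e)
outer (cell b₆ j d zero)    = cQ j d
outer (cell b₆ j d (suc e)) = cell b₁ j (suc d) e
outer (cell a₂ j d e)       = cell a₃ j d e
outer (cell a₃ j d e)       = cell a₂ j d e
outer (cell a₄ j d e)       = cell a₅ j d e
outer (cell a₅ j d e)       = cell a₄ j d e
outer (cell b₂ j d e)       = cell b₃ j d e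
outer (cell b₃ j d e)       = cell b₂ j d e
outer (cell b₄ j d e)       = cell b₅ j d e
outer (cell b₅ j d e)       = cell b₄ j d e
outer (cell c₁ j d e)       = cell c₂ j d e
outer (cell c₂ j d e)       = cell c₁ j d e
outer (cell c₃ j d e)       = cell c₄ j d e
outer (cell c₄ j d e)       = cell c₃ j d e

-- row e is the track of row r - e.
data Track : Set where
  row col : ℕ → Track
  local   : ℕ → ℕ → ℕ → Track

track : Node → Track
track (start e) = row e
track (end i)   = row 0
track (rP i e)  = row e
track (rQ i e)  = row e
track (cP i e)  = col i
track (cQ i e)  = col i
track (cell a₁ j d e) = row e
track (cell a₂ j d e) = row e
track (cell a₃ j d e) = row e
track (cell a₄ j d e) = row e
track (cell a₅ j d e) = row e
track (cell a₆ j d e) = row e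
track (cell b₁ j d e) = col j
track (cell b₂ j d e) = col j
track (cell b₃ j d e) = col j
track (cell b₄ j d e) = col j
track (cell b₅ j d e) = col j
track (cell b₆ j d e) = col j
track (cell c₁ j d e) = local j d e
track (cell c₂ j d e) = local j d e
track (cell c₃ j d e) = local j d e
track (cell c₄ j d e) = local j d e

Config : Set
Config = Track → Bool

mate : Config → Node → Node
mate ξ v = if ξ (track v) then inner v else outer v

fixed-involutive : ∀ v → fixed (fixed v) ≡ v
fixed-involutive (start e) = refl
fixed-involutive (end i) = refl
fixed-involutive (rP zero e) = refl
fixed-involutive (rP (suc i) e) = refl
fixed-involutive (rQ i e) = refl
fixed-involutive (cP i e) = refl
fixed-involutive (cQ i e) = refl
fixed-involutive (cell a₁ j d e) = refl
fixed-involutive (cell a₂ zero d e) = refl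
fixed-involutive (cell a₂ (suc j) d e) = refl
fixed-involutive (cell a₃ j d e) = refl
fixed-involutive (cell a₄ j d e) = refl
fixed-involutive (cell a₅ j d e) = refl
fixed-involutive (cell a₆ j d e) = refl
fixed-involutive (cell b₁ j d e) = refl
fixed-involutive (cell b₂ j d e) = refl
fixed-involutive (cell b₃ j d e) = refl
fixed-involutive (cell b₄ j d e) = refl
fixed-involutive (cell b₅ j d e) = refl
fixed-involutive (cell b₆ j d e) = refl
fixed-involutive (cell c₁ j d e) = refl
fixed-involutive (cell c₂ j d e) = refl
fixed-involutive (cell c₃ j d e) = refl
fixed-involutive (cell c₄ j zero zero) = refl
fixed-involutive (cell c₄ j zero (suc e)) = refl
fixed-involutive (cell c₄ j (suc d) e) = refl

inner-involutive : ∀ v → inner (inner v) ≡ v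
inner-involutive (start e) = refl
inner-involutive (end i) = refl
inner-involutive (rP i e) = refl
inner-involutive (rQ i e) = refl
inner-involutive (cP i e) = refl
inner-involutive (cQ i e) = refl
inner-involutive (cell a₁ j d e) = refl
inner-involutive (cell a₂ j d e) = refl
inner-involutive (cell a₃ j d e) = refl
inner-involutive (cell a₄ j d e) = refl
inner-involutive (cell a₅ j d e) = refl
inner-involutive (cell a₆ j d e) = refl
inner-involutive (cell b₁ j d e) = refl
inner-involutive (cell b₂ j d e) = refl
inner-involutive (cell b₃ j d e) = refl
inner-involutive (cell b₄ j d e) = refl
inner-involutive (cell b₅ j d e) = refl
inner-involutive (cell b₆ j d e) = refl
inner-involutive (cell c₁ j d e) = refl
inner-involutive (cell c₂ j d e) = refl
inner-involutive (cell c₃ j d e) = refl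
inner-involutive (cell c₄ j d e) = refl

outer-involutive : ∀ v → outer (outer v) ≡ v
outer-involutive (start e) = refl
outer-involutive (end i) = refl
outer-involutive (rP i e) = refl
outer-involutive (rQ i e) = refl
outer-involutive (cP i e) = refl
outer-involutive (cQ i e) = refl
outer-involutive (cell a₁ zero d e) = refl
outer-involutive (cell a₁ (suc j) d e) = refl
outer-involutive (cell a₂ j d e) = refl
outer-involutive (cell a₃ j d e) = refl
outer-involutive (cell a₄ j d e) = refl
outer-involutive (cell a₅ j d e) = refl
outer-involutive (cell a₆ j zero e) = refl
outer-involutive (cell a₆ j (suc d) e) = refl
outer-involutive (cell b₁ j zero e) = refl
outer-involutive (cell b₁ j (suc d) e) = refl
outer-involutive (cell b₂ j d e) = refl
outer-involutive (cell b₃ j d e) = refl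
outer-involutive (cell b₄ j d e) = refl
outer-involutive (cell b₅ j d e) = refl
outer-involutive (cell b₆ j d zero) = refl
outer-involutive (cell b₆ j d (suc e)) = refl
outer-involutive (cell c₁ j d e) = refl
outer-involutive (cell c₂ j d e) = refl
outer-involutive (cell c₃ j d e) = refl
outer-involutive (cell c₄ j d e) = refl

track-inner : ∀ v → track (inner v) ≡ track v
track-inner (start e) = refl
track-inner (end i) = refl
track-inner (rP i e) = refl
track-inner (rQ i e) = refl
track-inner (cP i e) = refl
track-inner (cQ i e) = refl
track-inner (cell a₁ j d e) = refl
track-inner (cell a₂ j d e) = refl
track-inner (cell a₃ j d e) = refl
track-inner (cell a₄ j d e) = refl
track-inner (cell a₅ j d e) = refl
track-inner (cell a₆ j d e) = refl
track-inner (cell b₁ j d e) = refl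
track-inner (cell b₂ j d e) = refl
track-inner (cell b₃ j d e) = refl
track-inner (cell b₄ j d e) = refl
track-inner (cell b₅ j d e) = refl
track-inner (cell b₆ j d e) = refl
track-inner (cell c₁ j d e) = refl
track-inner (cell c₂ j d e) = refl
track-inner (cell c₃ j d e) = refl
track-inner (cell c₄ j d e) = refl

track-outer : ∀ v → track (outer v) ≡ track v
track-outer (start e) = refl
track-outer (end i) = refl
track-outer (rP i e) = refl
track-outer (rQ i e) = refl
track-outer (cP i e) = refl
track-outer (cQ i e) = refl
track-outer (cell a₁ zero d e) = refl
track-outer (cell a₁ (suc j) d e) = refl
track-outer (cell a₂ j d e) = refl
track-outer (cell a₃ j d e) = refl
track-outer (cell a₄ j d e) = refl
track-outer (cell a₅ j d e) = refl
track-outer (cell a₆ j zero e) = refl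
track-outer (cell a₆ j (suc d) e) = refl
track-outer (cell b₁ j zero e) = refl
track-outer (cell b₁ j (suc d) e) = refl
track-outer (cell b₂ j d e) = refl
track-outer (cell b₃ j d e) = refl
track-outer (cell b₄ j d e) = refl
track-outer (cell b₅ j d e) = refl
track-outer (cell b₆ j d zero) = refl
track-outer (cell b₆ j d (suc e)) = refl
track-outer (cell c₁ j d e) = refl
track-outer (cell c₂ j d e) = refl
track-outer (cell c₃ j d e) = refl
track-outer (cell c₄ j d e) = refl

size-fixed : ∀ v → size (fixed v) ≡ size v
size-fixed (start e) = refl
size-fixed (end i) = trans (ℕ.+-identityʳ (i + 0)) (ℕ.+-identityʳ i)
size-fixed (rP zero e) = refl
size-fixed (rP (suc i) e) = trans (cong (_+ suc e) (ℕ.+-identityʳ i)) (ℕ.+-suc i e)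
size-fixed (rQ i e) = refl
size-fixed (cP i e) = refl
size-fixed (cQ i e) = refl
size-fixed (cell a₁ j d e) = refl
size-fixed (cell a₂ zero d e) = refl
size-fixed (cell a₂ (suc j) d e) = cong (_+ e) (ℕ.+-suc j d)
size-fixed (cell a₃ j d e) = refl
size-fixed (cell a₄ j d e) = refl
size-fixed (cell a₅ j d e) = refl
size-fixed (cell a₆ j d e) = refl
size-fixed (cell b₁ j d e) = refl
size-fixed (cell b₂ j d e) = refl
size-fixed (cell b₃ j d e) = refl
size-fixed (cell b₄ j d e) = refl
size-fixed (cell b₅ j d e) = refl
size-fixed (cell b₆ j d e) = refl
size-fixed (cell c₁ j d e) = refl
size-fixed (cell c₂ j d e) = refl
size-fixed (cell c₃ j d e) = refl
size-fixed (cell c₄ j zero zero) = sym (trans (ℕ.+-identityʳ (j + 0)) (ℕ.+-identityʳ j))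
size-fixed (cell c₄ j zero (suc e)) = sym (trans (cong (_+ suc e) (ℕ.+-identityʳ j)) (ℕ.+-suc j e))
size-fixed (cell c₄ j (suc d) e) = cong (_+ e) (sym (ℕ.+-suc j d))

size-inner : ∀ v → size (inner v) ≡ size v
size-inner (start e) = refl
size-inner (end i) = refl
size-inner (rP i e) = refl
size-inner (rQ i e) = refl
size-inner (cP i e) = refl
size-inner (cQ i e) = refl
size-inner (cell a₁ j d e) = refl
size-inner (cell a₂ j d e) = refl
size-inner (cell a₃ j d e) = refl
size-inner (cell a₄ j d e) = refl
size-inner (cell a₅ j d e) = refl
size-inner (cell a₆ j d e) = refl
size-inner (cell b₁ j d e) = refl
size-inner (cell b₂ j d e) = refl
size-inner (cell b₃ j d e) = refl
size-inner (cell b₄ j d e) = refl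
size-inner (cell b₅ j d e) = refl
size-inner (cell b₆ j d e) = refl
size-inner (cell c₁ j d e) = refl
size-inner (cell c₂ j d e) = refl
size-inner (cell c₃ j d e) = refl
size-inner (cell c₄ j d e) = refl

size-outer : ∀ v → size (outer v) ≡ size v
size-outer (start e) = refl
size-outer (end i) = refl
size-outer (rP i e) = refl
size-outer (rQ i e) = cong (_+ e) (ℕ.+-identityʳ i)
size-outer (cP i e) = cong (_+ e) (ℕ.+-identityʳ i)
size-outer (cQ i e) = ℕ.+-identityʳ (i + e)
size-outer (cell a₁ zero d e) = refl
size-outer (cell a₁ (suc j) d e) = cong (_+ e) (ℕ.+-suc j d)
size-outer (cell a₂ j d e) = refl
size-outer (cell a₃ j d e) = refl
size-outer (cell a₄ j d e) = refl
size-outer (cell a₅ j d e) = refl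
size-outer (cell a₆ j zero e) = cong (_+ e) (sym (ℕ.+-identityʳ j))
size-outer (cell a₆ j (suc d) e) = cong (_+ e) (sym (ℕ.+-suc j d))
size-outer (cell b₁ j zero e) = cong (_+ e) (sym (ℕ.+-identityʳ j))
size-outer (cell b₁ j (suc d) e) = trans (ℕ.+-suc (j + d) e) (cong (_+ e) (sym (ℕ.+-suc j d)))
size-outer (cell b₂ j d e) = refl
size-outer (cell b₃ j d e) = refl
size-outer (cell b₄ j d e) = refl
size-outer (cell b₅ j d e) = refl
size-outer (cell b₆ j d zero) = sym (ℕ.+-identityʳ (j + d))
size-outer (cell b₆ j d (suc e)) = trans (cong (_+ e) (ℕ.+-suc j d)) (sym (ℕ.+-suc (j + d) e))
size-outer (cell c₁ j d e) = refl
size-outer (cell c₂ j d e) = refl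
size-outer (cell c₃ j d e) = refl
size-outer (cell c₄ j d e) = refl

-- With `fixed≢outer` and `inner≢outer` this makes the three possible neighbours of an inside node
-- distinct, so that a degree bound of two applies to them.
fixed≢inner : ∀ v → fixed v ≢ inner v
fixed≢inner (start e) = λ ()
fixed≢inner (end i) = λ ()
fixed≢inner (rP zero e) = λ ()
fixed≢inner (rP (suc i) e) = λ ()
fixed≢inner (rQ i e) = λ ()
fixed≢inner (cP i e) = λ ()
fixed≢inner (cQ i e) = λ ()
fixed≢inner (cell a₁ j d e) = λ ()
fixed≢inner (cell a₂ zero d e) = λ ()
fixed≢inner (cell a₂ (suc j) d e) = λ ()
fixed≢inner (cell a₃ j d e) = λ ()
fixed≢inner (cell a₄ j d e) = λ ()
fixed≢inner (cell a₅ j d e) = λ ()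
fixed≢inner (cell a₆ j d e) = λ ()
fixed≢inner (cell b₁ j d e) = λ ()
fixed≢inner (cell b₂ j d e) = λ ()
fixed≢inner (cell b₃ j d e) = λ ()
fixed≢inner (cell b₄ j d e) = λ ()
fixed≢inner (cell b₅ j d e) = λ ()
fixed≢inner (cell b₆ j d e) = λ ()
fixed≢inner (cell c₁ j d e) = λ ()
fixed≢inner (cell c₂ j d e) = λ ()
fixed≢inner (cell c₃ j d e) = λ ()
fixed≢inner (cell c₄ j zero zero) = λ ()
fixed≢inner (cell c₄ j zero (suc e)) = λ ()
fixed≢inner (cell c₄ j (suc d) e) = λ ()

fixed≢outer : ∀ v → fixed v ≢ outer v
fixed≢outer (start e) = λ ()
fixed≢outer (end i) = λ ()
fixed≢outer (rP zero e) = λ ()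
fixed≢outer (rP (suc i) e) = λ ()
fixed≢outer (rQ i e) = λ ()
fixed≢outer (cP i e) = λ ()
fixed≢outer (cQ i e) = λ ()
fixed≢outer (cell a₁ zero d e) = λ ()
fixed≢outer (cell a₁ (suc j) d e) = λ ()
fixed≢outer (cell a₂ zero d e) = λ ()
fixed≢outer (cell a₂ (suc j) d e) = λ ()
fixed≢outer (cell a₃ j d e) = λ ()
fixed≢outer (cell a₄ j d e) = λ ()
fixed≢outer (cell a₅ j d e) = λ ()
fixed≢outer (cell a₆ j zero e) = λ ()
fixed≢outer (cell a₆ j (suc d) e) = λ ()
fixed≢outer (cell b₁ j zero e) = λ ()
fixed≢outer (cell b₁ j (suc d) e) = λ ()
fixed≢outer (cell b₂ j d e) = λ ()
fixed≢outer (cell b₃ j d e) = λ ()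
fixed≢outer (cell b₄ j d e) = λ ()
fixed≢outer (cell b₅ j d e) = λ ()
fixed≢outer (cell b₆ j d zero) = λ ()
fixed≢outer (cell b₆ j d (suc e)) = λ ()
fixed≢outer (cell c₁ j d e) = λ ()
fixed≢outer (cell c₂ j d e) = λ ()
fixed≢outer (cell c₃ j d e) = λ ()
fixed≢outer (cell c₄ j zero zero) = λ ()
fixed≢outer (cell c₄ j zero (suc e)) = λ ()
fixed≢outer (cell c₄ j (suc d) e) = λ ()

data Inside : Node → Set where
  inside-rP : ∀ {i e} → Inside (rP i e)
  inside-rQ : ∀ {i e} → Inside (rQ i e)
  inside-cP : ∀ {i e} → Inside (cP i e)
  inside-cQ : ∀ {i e} → Inside (cQ i e)
  inside-cell : ∀ {j d e p} → Inside (cell p j d e)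

inner≢outer : ∀ {v} → Inside v → inner v ≢ outer v
inner≢outer {rP i e} _ = λ ()
inner≢outer {rQ i e} _ = λ ()
inner≢outer {cP i e} _ = λ ()
inner≢outer {cQ i e} _ = λ ()
inner≢outer {cell a₁ zero d e} _ = λ ()
inner≢outer {cell a₁ (suc j) d e} _ = λ ()
inner≢outer {cell a₂ j d e} _ = λ ()
inner≢outer {cell a₃ j d e} _ = λ ()
inner≢outer {cell a₄ j d e} _ = λ ()
inner≢outer {cell a₅ j d e} _ = λ ()
inner≢outer {cell a₆ j zero e} _ = λ ()
inner≢outer {cell a₆ j (suc d) e} _ = λ ()
inner≢outer {cell b₁ j zero e} _ = λ ()
inner≢outer {cell b₁ j (suc d) e} _ = λ ()
inner≢outer {cell b₂ j d e} _ = λ ()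
inner≢outer {cell b₃ j d e} _ = λ ()
inner≢outer {cell b₄ j d e} _ = λ ()
inner≢outer {cell b₅ j d e} _ = λ ()
inner≢outer {cell b₆ j d zero} _ = λ ()
inner≢outer {cell b₆ j d (suc e)} _ = λ ()
inner≢outer {cell c₁ j d e} _ = λ ()
inner≢outer {cell c₂ j d e} _ = λ ()
inner≢outer {cell c₃ j d e} _ = λ ()
inner≢outer {cell c₄ j d e} _ = λ ()

v≢fixed : ∀ v → v ≢ fixed v
v≢fixed (start e) = λ ()
v≢fixed (end i) = λ ()
v≢fixed (rP zero e) = λ ()
v≢fixed (rP (suc i) e) = λ ()
v≢fixed (rQ i e) = λ ()
v≢fixed (cP i e) = λ ()
v≢fixed (cQ i e) = λ ()
v≢fixed (cell a₁ j d e) = λ ()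
v≢fixed (cell a₂ zero d e) = λ ()
v≢fixed (cell a₂ (suc j) d e) = λ ()
v≢fixed (cell a₃ j d e) = λ ()
v≢fixed (cell a₄ j d e) = λ ()
v≢fixed (cell a₅ j d e) = λ ()
v≢fixed (cell a₆ j d e) = λ ()
v≢fixed (cell b₁ j d e) = λ ()
v≢fixed (cell b₂ j d e) = λ ()
v≢fixed (cell b₃ j d e) = λ ()
v≢fixed (cell b₄ j d e) = λ ()
v≢fixed (cell b₅ j d e) = λ ()
v≢fixed (cell b₆ j d e) = λ ()
v≢fixed (cell c₁ j d e) = λ ()
v≢fixed (cell c₂ j d e) = λ ()
v≢fixed (cell c₃ j d e) = λ ()
v≢fixed (cell c₄ j zero zero) = λ ()
v≢fixed (cell c₄ j zero (suc e)) = λ ()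
v≢fixed (cell c₄ j (suc d) e) = λ ()

-- Numbering the spine

index : Port → ℕ
index a₁ = 0
index a₂ = 1
index a₃ = 2
index a₄ = 3
index a₅ = 4
index a₆ = 5
index b₁ = 6
index b₂ = 7
index b₃ = 8
index b₄ = 9
index b₅ = 10
index b₆ = 11
index c₁ = 12
index c₂ = 13
index c₃ = 14
index c₄ = 15

index<16 : ∀ p → index p < 16
index<16 p = ℕ.<ᵇ⇒< (index p) 16 (lt p)
  where
  lt : ∀ p → T (index p ℕ.<ᵇ 16)
  lt = λ where
    a₁ → tt
    a₂ → tt
    a₃ → tt
    a₄ → tt
    a₅ → tt
    a₆ → tt
    b₁ → tt
    b₂ → tt
    b₃ → tt
    b₄ → tt
    b₅ → tt
    b₆ → tt
    c₁ → tt
    c₂ → tt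
    c₃ → tt
    c₄ → tt

-- The number of nodes before row `i`: two path ends, and for each earlier row m its four caps `rP`,
-- `rQ`, `cP`, `cQ` and 16 ports in each of its m + 1 cells.
offset : ℕ → ℕ
offset zero    = 2
offset (suc i) = suc i * 16 + (4 + offset i)

code : Node → ℕ
code (start e)      = 0
code (end i)        = 1
code (rP i e)       = offset i
code (rQ i e)       = 1 + offset i
code (cP i e)       = 2 + offset i
code (cQ i e)       = 3 + offset i
code (cell p j d e) = index p + (j * 16 + (4 + offset (j + d)))

-- Within each size the nodes form a single chain under the following map, along which the code grows by one.
succ : Node → Node
succ (start e) = end e
succ (end i)   = rP 0 i
succ (rP i e)  = rQ i e
succ (rQ i e)  = cP i e
succ (cP i e)  = cQ i e
succ (cQ i e)  = cell a₁ 0 i e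
succ (cell a₁ j d e) = cell a₂ j d e
succ (cell a₂ j d e) = cell a₃ j d e
succ (cell a₃ j d e) = cell a₄ j d e
succ (cell a₄ j d e) = cell a₅ j d e
succ (cell a₅ j d e) = cell a₆ j d e
succ (cell a₆ j d e) = cell b₁ j d e
succ (cell b₁ j d e) = cell b₂ j d e
succ (cell b₂ j d e) = cell b₃ j d e
succ (cell b₃ j d e) = cell b₄ j d e
succ (cell b₄ j d e) = cell b₅ j d e
succ (cell b₅ j d e) = cell b₆ j d e
succ (cell b₆ j d e) = cell c₁ j d e
succ (cell c₁ j d e) = cell c₂ j d e
succ (cell c₂ j d e) = cell c₃ j d e
succ (cell c₃ j d e) = cell c₄ j d e
succ (cell c₄ j (suc d) e)    = cell a₁ (suc j) d e
succ (cell c₄ j zero (suc e)) = rP (suc j) e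
succ (cell c₄ j zero zero)    = cell c₄ j zero zero

size-succ : ∀ v → size (succ v) ≡ size v
size-succ (start e) = refl
size-succ (end i)   = refl
size-succ (rP i e)  = refl
size-succ (rQ i e)  = refl
size-succ (cP i e)  = refl
size-succ (cQ i e)  = refl
size-succ (cell a₁ j d e) = refl
size-succ (cell a₂ j d e) = refl
size-succ (cell a₃ j d e) = refl
size-succ (cell a₄ j d e) = refl
size-succ (cell a₅ j d e) = refl
size-succ (cell a₆ j d e) = refl
size-succ (cell b₁ j d e) = refl
size-succ (cell b₂ j d e) = refl
size-succ (cell b₃ j d e) = refl
size-succ (cell b₄ j d e) = refl
size-succ (cell b₅ j d e) = refl
size-succ (cell b₆ j d e) = refl
size-succ (cell c₁ j d e) = refl
size-succ (cell c₂ j d e) = refl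
size-succ (cell c₃ j d e) = refl
size-succ (cell c₄ j (suc d) e)    = cong (_+ e) (sym (ℕ.+-suc j d))
size-succ (cell c₄ j zero (suc e)) = sym (trans (cong (_+ suc e) (ℕ.+-identityʳ j)) (ℕ.+-suc j e))
size-succ (cell c₄ j zero zero)    = refl

-- The second alternative is the last port of the last diagonal cell, where `succ` is stationary and
-- the code has reached its maximum.
code-succ : ∀ v → code (succ v) ≡ suc (code v) ⊎ suc (code v) ≡ offset (suc (size v))
code-succ (start e) = inj₁ refl
code-succ (end i)   = inj₁ refl
code-succ (rP i e)  = inj₁ refl
code-succ (rQ i e)  = inj₁ refl
code-succ (cP i e)  = inj₁ refl
code-succ (cQ i e)  = inj₁ refl
code-succ (cell a₁ j d e) = inj₁ refl
code-succ (cell a₂ j d e) = inj₁ refl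
code-succ (cell a₃ j d e) = inj₁ refl
code-succ (cell a₄ j d e) = inj₁ refl
code-succ (cell a₅ j d e) = inj₁ refl
code-succ (cell a₆ j d e) = inj₁ refl
code-succ (cell b₁ j d e) = inj₁ refl
code-succ (cell b₂ j d e) = inj₁ refl
code-succ (cell b₃ j d e) = inj₁ refl
code-succ (cell b₄ j d e) = inj₁ refl
code-succ (cell b₅ j d e) = inj₁ refl
code-succ (cell b₆ j d e) = inj₁ refl
code-succ (cell c₁ j d e) = inj₁ refl
code-succ (cell c₂ j d e) = inj₁ refl
code-succ (cell c₃ j d e) = inj₁ refl
code-succ (cell c₄ j (suc d) e)    = inj₁ (cong (λ i → 16 + (j * 16 + (4 + offset i))) (sym (ℕ.+-suc j d)))
code-succ (cell c₄ j zero (suc e)) = inj₁ (cong (λ i → 16 + (j * 16 + (4 + offset i))) (sym (ℕ.+-identityʳ j)))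
code-succ (cell c₄ j zero zero)
  rewrite ℕ.+-identityʳ j | ℕ.+-identityʳ j = inj₂ refl

offset-<-suc : ∀ i → offset i < offset (suc i)
offset-<-suc i = ℕ.≤-trans (ℕ.m≤n+m (1 + offset i) 3) (ℕ.m≤n+m (4 + offset i) (suc i * 16))

offset-mono-≤ : ∀ {i j} → i ≤ j → offset i ≤ offset j
offset-mono-≤ {i} {j} i≤j with ℕ.m≤n⇒m<n∨m≡n i≤j
... | inj₂ refl = ℕ.≤-refl
offset-mono-≤ {i} {suc j} _ | inj₁ (s≤s i≤j) = ℕ.≤-trans (offset-mono-≤ i≤j) (ℕ.<⇒≤ (offset-<-suc j))

code-cell< : ∀ p j d e → code (cell p j d e) < offset (suc (j + d))
code-cell< p j d e = ℕ.≤-trans (ℕ.+-monoˡ-< (j * 16 + (4 + offset (j + d))) (index<16 p))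
  (subst (_≤ offset (suc (j + d))) (ℕ.+-assoc 16 (j * 16) (4 + offset (j + d)))
    (ℕ.+-monoˡ-≤ (4 + offset (j + d)) (ℕ.*-monoˡ-≤ 16 (s≤s (ℕ.m≤m+n j d)))))

cap< : ∀ m i → m < 4 → m + offset i < offset (suc i)
cap< m i m<4 = ℕ.≤-trans (ℕ.+-monoˡ-< (offset i) m<4) (ℕ.m≤n+m (4 + offset i) (suc i * 16))

offset₀≤ : ∀ i → 2 ≤ offset i
offset₀≤ i = offset-mono-≤ {0} {i} z≤n

module Coding (r : ℕ) where

  N : ℕ
  N = offset (suc r)

  code<N : ∀ v → size v ≡ r → code v < N
  code<N (start e) _ = ℕ.≤-trans (s≤s z≤n) (offset₀≤ (suc r))
  code<N (end i)   _ = offset₀≤ (suc r)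
  code<N (rP i e) refl = ℕ.<-≤-trans (cap< 0 i (s≤s z≤n)) (offset-mono-≤ (s≤s (ℕ.m≤m+n i e)))
  code<N (rQ i e) refl = ℕ.<-≤-trans (cap< 1 i (s≤s (s≤s z≤n))) (offset-mono-≤ (s≤s (ℕ.m≤m+n i e)))
  code<N (cP i e) refl = ℕ.<-≤-trans (cap< 2 i (s≤s (s≤s (s≤s z≤n)))) (offset-mono-≤ (s≤s (ℕ.m≤m+n i e)))
  code<N (cQ i e) refl = ℕ.<-≤-trans (cap< 3 i ℕ.≤-refl) (offset-mono-≤ (s≤s (ℕ.m≤m+n i e)))
  code<N (cell p j d e) refl = ℕ.<-≤-trans (code-cell< p j d e) (offset-mono-≤ (s≤s (ℕ.m≤m+n (j + d) e)))

  decode : ℕ → Node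
  decode zero    = start r
  decode (suc u) = succ (decode u)

  size-decode : ∀ u → size (decode u) ≡ r
  size-decode zero    = refl
  size-decode (suc u) = trans (size-succ (decode u)) (size-decode u)

  code-decode : ∀ {u} → u < N → code (decode u) ≡ u
  code-decode {zero}  _    = refl
  code-decode {suc u} su<N with code-succ (decode u) | code-decode (ℕ.<-trans (ℕ.n<1+n u) su<N)
  ... | inj₁ eq | ih = trans eq (cong suc ih)
  ... | inj₂ eq | ih = ⊥-elim (ℕ.<-irrefl (trans (cong suc (sym ih)) (trans eq (cong (λ m → offset (suc m)) (size-decode u)))) su<N)

  Hit : Node → Set
  Hit v = decode (code v) ≡ v

  hit-succ : ∀ {v} → code (succ v) ≡ suc (code v) → Hit v → Hit (succ v)
  hit-succ eq h = trans (cong decode eq) (cong succ h)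

  hit-cell : ∀ {j d e} → Hit (cell a₁ j d e) → ∀ p → Hit (cell p j d e)
  hit-cell {j} {d} {e} ha₁ = λ where
      a₁ → ha₁
      a₂ → ha₂
      a₃ → ha₃
      a₄ → ha₄
      a₅ → ha₅
      a₆ → ha₆
      b₁ → hb₁
      b₂ → hb₂
      b₃ → hb₃
      b₄ → hb₄
      b₅ → hb₅
      b₆ → hb₆
      c₁ → hc₁
      c₂ → hc₂
      c₃ → hc₃
      c₄ → hc₄
    where
    ha₂ = cong succ ha₁
    ha₃ = cong succ ha₂
    ha₄ = cong succ ha₃
    ha₅ = cong succ ha₄
    ha₆ = cong succ ha₅
    hb₁ = cong succ ha₆
    hb₂ = cong succ hb₁
    hb₃ = cong succ hb₂
    hb₄ = cong succ hb₃
    hb₅ = cong succ hb₄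
    hb₆ = cong succ hb₅
    hc₁ = cong succ hb₆
    hc₂ = cong succ hc₁
    hc₃ = cong succ hc₂
    hc₄ = cong succ hc₃

  -- The chain reaches cell `j` of a row from cell `j - 1`. The row index `j + d` stays the same in
  -- the recursion, so `d` grows as `j` decreases.
  hit-row : ∀ j d e → Hit (rP (j + d) e) → ∀ p → Hit (cell p j d e)
  hit-row zero    d e h = hit-cell (cong succ (cong succ (cong succ (cong succ h))))
  hit-row (suc j) d e h = hit-cell (hit-succ (code-succ-down j d e)
    (hit-row j (suc d) e (subst (λ i → Hit (rP i e)) (sym (ℕ.+-suc j d)) h) c₄))
    where
    code-succ-down : ∀ j d e → code (cell a₁ (suc j) d e) ≡ suc (code (cell c₄ j (suc d) e))
    code-succ-down j d e = cong (λ i → 16 + (j * 16 + (4 + offset i))) (sym (ℕ.+-suc j d))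

  hit-rP : ∀ i e → i + e ≡ r → Hit (rP i e)
  hit-rP zero    e refl = refl
  hit-rP (suc i) e eq   = hit-succ (cong (λ m → 16 + (i * 16 + (4 + offset m))) (sym (ℕ.+-identityʳ i)))
    (hit-row i 0 (suc e) (subst (λ m → Hit (rP m (suc e))) (sym (ℕ.+-identityʳ i))
      (hit-rP i (suc e) (trans (ℕ.+-suc i e) eq))) c₄)

  decode-code : ∀ v → size v ≡ r → decode (code v) ≡ v
  decode-code (start e) refl = refl
  decode-code (end i)   refl = refl
  decode-code (rP i e)  eq   = hit-rP i e eq
  decode-code (rQ i e)  eq   = cong succ (hit-rP i e eq)
  decode-code (cP i e)  eq   = cong succ (cong succ (hit-rP i e eq))
  decode-code (cQ i e)  eq   = cong succ (cong succ (cong succ (hit-rP i e eq)))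
  decode-code (cell p j d e) eq = hit-row j d e (hit-rP (j + d) e eq) p

-- The Hamiltonian path

Even : Config → Set
Even ξ = ∀ j d e → ξ (local j d e) ≡ ξ (row e) xor ξ (col j)

-- The position of a port on the strand from a₂ to c₄, for given modes of row and column; 0 if the strand avoids
-- the port, which happens only to a₁, a₆, b₁ and b₆.
visit : Bool → Bool → Port → ℕ
visit _     _     a₂ = 0
visit _     _     c₄ = 15
visit false false a₃ = 1
visit false false b₂ = 2
visit false false b₃ = 3
visit false false c₁ = 4
visit false false c₂ = 5
visit false false a₄ = 6
visit false false a₅ = 7
visit false false b₄ = 8
visit false false b₅ = 9
visit false false c₃ = 10
visit true  false a₁ = 1
visit true  false a₆ = 2
visit true  false a₅ = 3
visit true  false b₄ = 4
visit true  false b₅ = 5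
visit true  false c₃ = 6
visit true  false c₂ = 7
visit true  false a₄ = 8
visit true  false a₃ = 9
visit true  false b₂ = 10
visit true  false b₃ = 11
visit true  false c₁ = 12
visit false true  a₃ = 1
visit false true  b₂ = 2
visit false true  b₁ = 3
visit false true  b₆ = 4
visit false true  b₅ = 5
visit false true  c₃ = 6
visit false true  c₂ = 7
visit false true  a₄ = 8
visit false true  a₅ = 9
visit false true  b₄ = 10
visit false true  b₃ = 11
visit false true  c₁ = 12
visit true  true  a₁ = 1
visit true  true  a₆ = 2
visit true  true  a₅ = 3
visit true  true  b₄ = 4
visit true  true  b₃ = 5
visit true  true  c₁ = 6
visit true  true  c₂ = 7
visit true  true  a₄ = 8
visit true  true  a₃ = 9
visit true  true  b₂ = 10
visit true  true  b₁ = 11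
visit true  true  b₆ = 12
visit true  true  b₅ = 13
visit true  true  c₃ = 14
visit _     _     _  = 0

module Ranking (ξ : Config) (r : ℕ) where

  -- Exceeds every second component of `place` that has to be compared across blocks: positions on a
  -- strand are below 16, and positions on a detour through the skipped pairs of a row or column are
  -- at most `2 + r * 2`.
  K : ℕ
  K = 16 + r * 2

  main : ℕ → ℕ → ℕ
  main j d = j + (4 + offset (j + d))

  -- The order along the path as (block, position in the block). Every cap opens a block and every
  -- strand is one. Pairs skipped by the strands of a row in outer mode belong to the block of its
  -- `rP`, numbered by their column; for a column they belong to the block of its `cP`, numbered by
  -- `d`.
  place : Node → ℕ × ℕ
  place (start e) = 0 , 0
  place (end i)   = offset (suc i) , 0
  place (rP i e)  = offset i , 0
  place (rQ i e)  = 1 + offset i , 0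
  place (cP i e)  = 2 + offset i , 0
  place (cQ i e)  = 3 + offset i , 0
  place (cell a₁ j d e) = if ξ (row e) then (main j d , visit (ξ (row e)) (ξ (col j)) a₁) else (offset (j + d) , 1 + j * 2)
  place (cell a₆ j d e) = if ξ (row e) then (main j d , visit (ξ (row e)) (ξ (col j)) a₆) else (offset (j + d) , 2 + j * 2)
  place (cell b₁ j d e) = if ξ (col j) then (main j d , visit (ξ (row e)) (ξ (col j)) b₁) else (2 + offset j , 1 + d * 2)
  place (cell b₆ j d e) = if ξ (col j) then (main j d , visit (ξ (row e)) (ξ (col j)) b₆) else (2 + offset j , 2 + d * 2)
  place (cell p j d e)  = main j d , visit (ξ (row e)) (ξ (col j)) p

  data _≺_ : ℕ × ℕ → ℕ × ℕ → Set where
    across : ∀ {b x b′ y} → b < b′ → x < K → (b , x) ≺ (b′ , y)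
    within : ∀ {b x b′ y} → b ≡ b′ → x < y → (b , x) ≺ (b′ , y)

  ahead : ∀ {b x y} {_ : T (x <ᵇ y)} → (b , x) ≺ (b , y)
  ahead {x = x} {y} {x<y} = within refl (ℕ.<ᵇ⇒< x y x<y)

  Flow : Node → Set
  Flow v = (place (fixed v) ≺ place v × place v ≺ place (mate ξ v))
         ⊎ (place (mate ξ v) ≺ place v × place v ≺ place (fixed v))

  lit : ∀ {x} {_ : T (x <ᵇ 16)} → x < K
  lit {x} {p} = ℕ.<-≤-trans (ℕ.<ᵇ⇒< x 16 p) (ℕ.m≤m+n 16 (r * 2))

  2+i*2<K : ∀ {i} → i ≤ r → 2 + i * 2 < K
  2+i*2<K i≤r = ℕ.+-mono-<-≤ {2} {16} (s≤s (s≤s (s≤s z≤n))) (ℕ.*-monoˡ-≤ 2 i≤r)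

  j≤r : ∀ j d e → (j + d) + e ≡ r → j ≤ r
  j≤r j d e sz = subst (j ≤_) sz (ℕ.≤-trans (ℕ.m≤m+n j d) (ℕ.m≤m+n (j + d) e))

  d≤r : ∀ j d e → (j + d) + e ≡ r → d ≤ r
  d≤r j d e sz = subst (d ≤_) sz (ℕ.≤-trans (ℕ.m≤n+m d j) (ℕ.m≤m+n (j + d) e))

  main<offset : ∀ j → main j 0 < offset (suc j)
  main<offset j = subst (λ m → j + (4 + offset m) < suc j * 16 + (4 + offset j)) (sym (ℕ.+-identityʳ j))
    (ℕ.+-monoˡ-< (4 + offset j) (s≤s (ℕ.≤-trans (ℕ.m≤m*n j 16) (ℕ.m≤n+m (j * 16) 15))))

  row-exit : ∀ j e → (j + 0) + e ≡ r → (offset (j + 0) , 2 + j * 2) ≺ (1 + offset j , 0)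
  row-exit j e sz = across (ℕ.≤-reflexive (cong (λ m → suc (offset m)) (ℕ.+-identityʳ j))) (2+i*2<K (j≤r j 0 e sz))

  main-next : ∀ j d → main j (suc d) < main (suc j) d
  main-next j d = s≤s (ℕ.≤-reflexive (cong (λ m → j + (4 + offset m)) (ℕ.+-suc j d)))

  start-flow : place (start r) ≺ place (fixed (start r))
  start-flow = across (s≤s z≤n) lit

  end-flow : place (fixed (end r)) ≺ place (end r)
  end-flow = across (main<offset r) lit

  flow-row : ∀ i e → i + e ≡ r → ∀ x → ξ (row e) ≡ x → Flow (rP i e) × Flow (rQ i e)
  flow-row i e sz x eq = P-flow i x eq , Q-flow x eq
    where
    P-flow : ∀ i x → ξ (row e) ≡ x → Flow (rP i e)
    P-flow zero true eq rewrite eq = inj₁ (across (s≤s z≤n) lit , across ℕ.≤-refl lit)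
    -- The repeated `rewrite` reaches the mode inside `place`, which appears only once `mate` has
    -- reduced to a node. The later clauses repeat their equations for the same reason.
    P-flow zero false eq rewrite eq | eq = inj₁ (across (s≤s z≤n) lit , ahead)
    P-flow (suc i) true eq rewrite eq = inj₁ (across (main<offset i) lit , across ℕ.≤-refl lit)
    P-flow (suc i) false eq rewrite eq | eq = inj₁ (across (main<offset i) lit , ahead)
    Q-flow : ∀ x → ξ (row e) ≡ x → Flow (rQ i e)
    Q-flow true eq rewrite eq = inj₂ (across ℕ.≤-refl lit , across ℕ.≤-refl lit)
    Q-flow false eq rewrite eq | eq = inj₂
      (across (ℕ.≤-reflexive (cong (λ m → suc (offset m)) (ℕ.+-identityʳ i))) (2+i*2<K (subst (i ≤_) sz (ℕ.m≤m+n i e)))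
      , across ℕ.≤-refl lit)

  flow-col : ∀ j e → j + e ≡ r → ∀ x → ξ (col j) ≡ x → Flow (cP j e) × Flow (cQ j e)
  flow-col j e sz x eq = P-flow x eq , Q-flow x eq
    where
    P-flow : ∀ x → ξ (col j) ≡ x → Flow (cP j e)
    P-flow true eq rewrite eq = inj₁ (across ℕ.≤-refl lit , across ℕ.≤-refl lit)
    P-flow false eq rewrite eq | eq = inj₁ (across ℕ.≤-refl lit , ahead)
    Q-flow : ∀ x → ξ (col j) ≡ x → Flow (cQ j e)
    Q-flow true eq rewrite eq = inj₂ (across ℕ.≤-refl lit , across ℕ.≤-refl lit)
    Q-flow false eq rewrite eq | eq = inj₂
      (across ℕ.≤-refl (2+i*2<K (subst (e ≤_) sz (ℕ.m≤n+m e j))) , across ℕ.≤-refl lit)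

  -- For fixed modes of row and column, the even parity `eql` sets the local switch so that the
  -- strand traverses both lanes; only then is the order given by `visit` the order along the path.
  flow-cell : ∀ p j d e → (j + d) + e ≡ r → ∀ x y → ξ (row e) ≡ x → ξ (col j) ≡ y → ξ (local j d e) ≡ x xor y → Flow (cell p j d e)
  flow-cell a₁ zero d e sz false false eqr eqc eql rewrite eqr = inj₂ (ahead , within refl ℕ.≤-refl)
  flow-cell a₁ (suc j) d e sz false false eqr eqc eql rewrite eqr | eqr = inj₂ (within (cong offset (ℕ.+-suc j d)) ℕ.≤-refl , within refl ℕ.≤-refl)
  flow-cell a₁ j d e sz true  false eqr eqc eql rewrite eqr | eqc = inj₂ (ahead , ahead)
  flow-cell a₁ zero d e sz false true  eqr eqc eql rewrite eqr = inj₂ (ahead , within refl ℕ.≤-refl)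
  flow-cell a₁ (suc j) d e sz false true  eqr eqc eql rewrite eqr | eqr = inj₂ (within (cong offset (ℕ.+-suc j d)) ℕ.≤-refl , within refl ℕ.≤-refl)
  flow-cell a₁ j d e sz true  true  eqr eqc eql rewrite eqr | eqc = inj₂ (ahead , ahead)
  flow-cell a₂ zero d e sz false false eqr eqc eql rewrite eqr | eqc | eqr = inj₁ (across ℕ.≤-refl lit , ahead)
  flow-cell a₂ (suc j) d e sz false false eqr eqc eql rewrite eqr | eqc | eqr = inj₁ (across (main-next j d) lit , ahead)
  flow-cell a₂ zero d e sz true  false eqr eqc eql rewrite eqr | eqc | eqr = inj₁ (across ℕ.≤-refl lit , ahead)
  flow-cell a₂ (suc j) d e sz true  false eqr eqc eql rewrite eqr | eqc | eqr = inj₁ (across (main-next j d) lit , ahead)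
  flow-cell a₂ zero d e sz false true  eqr eqc eql rewrite eqr | eqc | eqr = inj₁ (across ℕ.≤-refl lit , ahead)
  flow-cell a₂ (suc j) d e sz false true  eqr eqc eql rewrite eqr | eqc | eqr = inj₁ (across (main-next j d) lit , ahead)
  flow-cell a₂ zero d e sz true  true  eqr eqc eql rewrite eqr | eqc | eqr = inj₁ (across ℕ.≤-refl lit , ahead)
  flow-cell a₂ (suc j) d e sz true  true  eqr eqc eql rewrite eqr | eqc | eqr = inj₁ (across (main-next j d) lit , ahead)
  flow-cell a₃ j d e sz false false eqr eqc eql rewrite eqr | eqc = inj₂ (ahead , ahead)
  flow-cell a₃ j d e sz true  false eqr eqc eql rewrite eqr | eqc | eqr = inj₂ (ahead , ahead)
  flow-cell a₃ j d e sz false true  eqr eqc eql rewrite eqr | eqc = inj₂ (ahead , ahead)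
  flow-cell a₃ j d e sz true  true  eqr eqc eql rewrite eqr | eqc | eqr = inj₂ (ahead , ahead)
  flow-cell a₄ j d e sz false false eqr eqc eql rewrite eqr | eqc | eqr = inj₁ (ahead , ahead)
  flow-cell a₄ j d e sz true  false eqr eqc eql rewrite eqr | eqc | eqr = inj₁ (ahead , ahead)
  flow-cell a₄ j d e sz false true  eqr eqc eql rewrite eqr | eqc | eqr = inj₁ (ahead , ahead)
  flow-cell a₄ j d e sz true  true  eqr eqc eql rewrite eqr | eqc | eqr = inj₁ (ahead , ahead)
  flow-cell a₅ j d e sz false false eqr eqc eql rewrite eqr | eqc | eqr = inj₂ (ahead , ahead)
  flow-cell a₅ j d e sz true  false eqr eqc eql rewrite eqr | eqc | eqr = inj₂ (ahead , ahead)
  flow-cell a₅ j d e sz false true  eqr eqc eql rewrite eqr | eqc | eqr = inj₂ (ahead , ahead)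
  flow-cell a₅ j d e sz true  true  eqr eqc eql rewrite eqr | eqc | eqr = inj₂ (ahead , ahead)
  flow-cell a₆ j zero e sz false false eqr eqc eql rewrite eqr = inj₁ (within refl ℕ.≤-refl , row-exit j e sz)
  flow-cell a₆ j (suc d) e sz false false eqr eqc eql rewrite eqr | eqr = inj₁ (within refl ℕ.≤-refl , within (cong offset (ℕ.+-suc j d)) ℕ.≤-refl)
  flow-cell a₆ j d e sz true  false eqr eqc eql rewrite eqr | eqc | eqr = inj₁ (ahead , ahead)
  flow-cell a₆ j zero e sz false true  eqr eqc eql rewrite eqr = inj₁ (within refl ℕ.≤-refl , row-exit j e sz)
  flow-cell a₆ j (suc d) e sz false true  eqr eqc eql rewrite eqr | eqr = inj₁ (within refl ℕ.≤-refl , within (cong offset (ℕ.+-suc j d)) ℕ.≤-refl)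
  flow-cell a₆ j d e sz true  true  eqr eqc eql rewrite eqr | eqc | eqr = inj₁ (ahead , ahead)
  flow-cell b₁ j zero e sz false false eqr eqc eql rewrite eqr | eqc = inj₂ (ahead , within refl ℕ.≤-refl)
  flow-cell b₁ j (suc d) e sz false false eqr eqc eql rewrite eqr | eqc | eqc = inj₂ (within refl ℕ.≤-refl , within refl ℕ.≤-refl)
  flow-cell b₁ j zero e sz true  false eqr eqc eql rewrite eqr | eqc = inj₂ (ahead , within refl ℕ.≤-refl)
  flow-cell b₁ j (suc d) e sz true  false eqr eqc eql rewrite eqr | eqc | eqc = inj₂ (within refl ℕ.≤-refl , within refl ℕ.≤-refl)
  flow-cell b₁ j d e sz false true  eqr eqc eql rewrite eqr | eqc | eqr | eqc = inj₂ (ahead , ahead)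
  flow-cell b₁ j d e sz true  true  eqr eqc eql rewrite eqr | eqc | eqr | eqc = inj₂ (ahead , ahead)
  flow-cell b₂ j d e sz false false eqr eqc eql rewrite eqr | eqc | eqr | eqc = inj₁ (ahead , ahead)
  flow-cell b₂ j d e sz true  false eqr eqc eql rewrite eqr | eqc | eqr | eqc = inj₁ (ahead , ahead)
  flow-cell b₂ j d e sz false true  eqr eqc eql rewrite eqr | eqc | eqr | eqc = inj₁ (ahead , ahead)
  flow-cell b₂ j d e sz true  true  eqr eqc eql rewrite eqr | eqc | eqr | eqc = inj₁ (ahead , ahead)
  flow-cell b₃ j d e sz false false eqr eqc eql rewrite eqr | eqc | eqr | eqc = inj₂ (ahead , ahead)
  flow-cell b₃ j d e sz true  false eqr eqc eql rewrite eqr | eqc | eqr | eqc = inj₂ (ahead , ahead)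
  flow-cell b₃ j d e sz false true  eqr eqc eql rewrite eqr | eqc | eqr | eqc = inj₂ (ahead , ahead)
  flow-cell b₃ j d e sz true  true  eqr eqc eql rewrite eqr | eqc | eqr | eqc = inj₂ (ahead , ahead)
  flow-cell b₄ j d e sz false false eqr eqc eql rewrite eqr | eqc | eqr | eqc = inj₁ (ahead , ahead)
  flow-cell b₄ j d e sz true  false eqr eqc eql rewrite eqr | eqc | eqr | eqc = inj₁ (ahead , ahead)
  flow-cell b₄ j d e sz false true  eqr eqc eql rewrite eqr | eqc | eqr | eqc = inj₁ (ahead , ahead)
  flow-cell b₄ j d e sz true  true  eqr eqc eql rewrite eqr | eqc | eqr | eqc = inj₁ (ahead , ahead)
  flow-cell b₅ j d e sz false false eqr eqc eql rewrite eqr | eqc | eqr | eqc = inj₂ (ahead , ahead)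
  flow-cell b₅ j d e sz true  false eqr eqc eql rewrite eqr | eqc | eqr | eqc = inj₂ (ahead , ahead)
  flow-cell b₅ j d e sz false true  eqr eqc eql rewrite eqr | eqc | eqr | eqc = inj₂ (ahead , ahead)
  flow-cell b₅ j d e sz true  true  eqr eqc eql rewrite eqr | eqc | eqr | eqc = inj₂ (ahead , ahead)
  flow-cell b₆ j d zero sz false false eqr eqc eql rewrite eqr | eqc = inj₁ (within refl ℕ.≤-refl , across ℕ.≤-refl (2+i*2<K (d≤r j d zero sz)))
  flow-cell b₆ j d (suc e) sz false false eqr eqc eql rewrite eqr | eqc | eqc = inj₁ (within refl ℕ.≤-refl , within refl ℕ.≤-refl)
  flow-cell b₆ j d zero sz true  false eqr eqc eql rewrite eqr | eqc = inj₁ (within refl ℕ.≤-refl , across ℕ.≤-refl (2+i*2<K (d≤r j d zero sz)))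
  flow-cell b₆ j d (suc e) sz true  false eqr eqc eql rewrite eqr | eqc | eqc = inj₁ (within refl ℕ.≤-refl , within refl ℕ.≤-refl)
  flow-cell b₆ j d e sz false true  eqr eqc eql rewrite eqr | eqc | eqr | eqc = inj₁ (ahead , ahead)
  flow-cell b₆ j d e sz true  true  eqr eqc eql rewrite eqr | eqc | eqr | eqc = inj₁ (ahead , ahead)
  flow-cell c₁ j d e sz false false eqr eqc eql rewrite eqr | eqc | eql | eqr | eqc = inj₁ (ahead , ahead)
  flow-cell c₁ j d e sz true  false eqr eqc eql rewrite eqr | eqc | eql = inj₁ (ahead , ahead)
  flow-cell c₁ j d e sz false true  eqr eqc eql rewrite eqr | eqc | eql = inj₁ (ahead , ahead)
  flow-cell c₁ j d e sz true  true  eqr eqc eql rewrite eqr | eqc | eql | eqr | eqc = inj₁ (ahead , ahead)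
  flow-cell c₂ j d e sz false false eqr eqc eql rewrite eqr | eqc | eql | eqr | eqc = inj₂ (ahead , ahead)
  flow-cell c₂ j d e sz true  false eqr eqc eql rewrite eqr | eqc | eql | eqr | eqc = inj₂ (ahead , ahead)
  flow-cell c₂ j d e sz false true  eqr eqc eql rewrite eqr | eqc | eql | eqr | eqc = inj₂ (ahead , ahead)
  flow-cell c₂ j d e sz true  true  eqr eqc eql rewrite eqr | eqc | eql | eqr | eqc = inj₂ (ahead , ahead)
  flow-cell c₃ j d e sz false false eqr eqc eql rewrite eqr | eqc | eql = inj₁ (ahead , ahead)
  flow-cell c₃ j d e sz true  false eqr eqc eql rewrite eqr | eqc | eql | eqr | eqc = inj₁ (ahead , ahead)
  flow-cell c₃ j d e sz false true  eqr eqc eql rewrite eqr | eqc | eql | eqr | eqc = inj₁ (ahead , ahead)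
  flow-cell c₃ j d e sz true  true  eqr eqc eql rewrite eqr | eqc | eql = inj₁ (ahead , ahead)
  flow-cell c₄ j (suc d) e sz false false eqr eqc eql rewrite eql | eqr | eqc = inj₂ (ahead , across (main-next j d) lit)
  flow-cell c₄ j zero (suc e) sz false false eqr eqc eql rewrite eql | eqr | eqc = inj₂ (ahead , across (main<offset j) lit)
  flow-cell c₄ j zero zero sz false false eqr eqc eql rewrite eql | eqr | eqc = inj₂ (ahead , across (main<offset j) lit)
  flow-cell c₄ j (suc d) e sz true  false eqr eqc eql rewrite eql | eqr | eqc = inj₂ (ahead , across (main-next j d) lit)
  flow-cell c₄ j zero (suc e) sz true  false eqr eqc eql rewrite eql | eqr | eqc = inj₂ (ahead , across (main<offset j) lit)
  flow-cell c₄ j zero zero sz true  false eqr eqc eql rewrite eql | eqr | eqc = inj₂ (ahead , across (main<offset j) lit)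
  flow-cell c₄ j (suc d) e sz false true  eqr eqc eql rewrite eql | eqr | eqc = inj₂ (ahead , across (main-next j d) lit)
  flow-cell c₄ j zero (suc e) sz false true  eqr eqc eql rewrite eql | eqr | eqc = inj₂ (ahead , across (main<offset j) lit)
  flow-cell c₄ j zero zero sz false true  eqr eqc eql rewrite eql | eqr | eqc = inj₂ (ahead , across (main<offset j) lit)
  flow-cell c₄ j (suc d) e sz true  true  eqr eqc eql rewrite eql | eqr | eqc = inj₂ (ahead , across (main-next j d) lit)
  flow-cell c₄ j zero (suc e) sz true  true  eqr eqc eql rewrite eql | eqr | eqc = inj₂ (ahead , across (main<offset j) lit)
  flow-cell c₄ j zero zero sz true  true  eqr eqc eql rewrite eql | eqr | eqc = inj₂ (ahead , across (main<offset j) lit)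

  flow : Even ξ → ∀ v → size v ≡ r → Inside v → Flow v
  flow even (rP i e)       sz _ = proj₁ (flow-row i e sz _ refl)
  flow even (rQ i e)       sz _ = proj₂ (flow-row i e sz _ refl)
  flow even (cP j e)       sz _ = proj₁ (flow-col j e sz _ refl)
  flow even (cQ j e)       sz _ = proj₂ (flow-col j e sz _ refl)
  flow even (cell p j d e) sz _ = flow-cell p j d e sz _ _ refl refl (even j d e)

supremum : (ℕ → ℕ) → ℕ → ℕ
supremum f zero    = 0
supremum f (suc n) = suc (f n) ⊔ supremum f n

<-supremum : ∀ f {n u} → u < n → f u < supremum f n
<-supremum f {suc n} {u} (s≤s u≤n) with ℕ.m≤n⇒m<n∨m≡n u≤n
... | inj₁ u<n = ℕ.<-≤-trans (<-supremum f u<n) (ℕ.m≤n⊔m (suc (f n)) (supremum f n))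
... | inj₂ refl = ℕ.m≤m⊔n (suc (f n)) (supremum f n)

data Kind : Node → Set where
  is-start  : ∀ {e} → Kind (start e)
  is-end    : ∀ {i} → Kind (end i)
  is-inside : ∀ {v} → Inside v → Kind v

kind : ∀ v → Kind v
kind (start e)      = is-start
kind (end i)        = is-end
kind (rP i e)       = is-inside inside-rP
kind (rQ i e)       = is-inside inside-rQ
kind (cP i e)       = is-inside inside-cP
kind (cQ i e)       = is-inside inside-cQ
kind (cell p j d e) = is-inside inside-cell

-- Both ends of an inner or outer edge lie on one track and so read the same mode.
mate-involutive : ∀ ξ v → mate ξ (mate ξ v) ≡ v
mate-involutive ξ v with ξ (track v) in eq
... | true  rewrite track-inner v | eq = inner-involutive v
... | false rewrite track-outer v | eq = outer-involutive v

size-mate : ∀ ξ v → size (mate ξ v) ≡ size v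
size-mate ξ v with ξ (track v)
... | true  = size-inner v
... | false = size-outer v

mate-start : ∀ ξ e → mate ξ (start e) ≡ start e
mate-start ξ e = Bool.if-eta (ξ (row e))

mate-end : ∀ ξ i → mate ξ (end i) ≡ end i
mate-end ξ i = Bool.if-eta (ξ (row 0))

true⇔true : ∀ {a b} → (a ≡ true → b ≡ true) → (b ≡ true → a ≡ true) → a ≡ b
true⇔true {true}  f g = sym (f refl)
true⇔true {false} {true} f g = g refl
true⇔true {false} {false} f g = refl

module Track-graph (r : ℕ) where
  open Coding r public

  Near : Config → Node → Node → Set
  Near ξ v w = w ≡ fixed v ⊎ w ≡ mate ξ v

  adj : Config → ℕ → ℕ → Bool
  adj ξ u v = (code (fixed (decode u)) ≡ᵇ v) ∨ (code (mate ξ (decode u)) ≡ᵇ v)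

  size-near : ∀ ξ {v w} → Near ξ v w → size v ≡ r → size w ≡ r
  size-near ξ {v} (inj₁ refl) sz = trans (size-fixed v) sz
  size-near ξ {v} (inj₂ refl) sz = trans (size-mate ξ v) sz

  near-sym : ∀ ξ {v w} → Near ξ v w → Near ξ w v
  near-sym ξ {v} (inj₁ refl) = inj₁ (sym (fixed-involutive v))
  near-sym ξ {v} (inj₂ refl) = inj₂ (sym (mate-involutive ξ v))

  adj⇒near : ∀ ξ u v → adj ξ u v ≡ true → Near ξ (decode u) (decode v)
  adj⇒near ξ u v eq with code (fixed (decode u)) ≡ᵇ v in eq₁
  ... | true  = inj₁ (trans (cong decode (sym (true-≡ᵇ (code (fixed (decode u))) v eq₁)))
                  (decode-code _ (trans (size-fixed (decode u)) (size-decode u))))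
  ... | false = inj₂ (trans (cong decode (sym (true-≡ᵇ (code (mate ξ (decode u))) v eq)))
                  (decode-code _ (trans (size-mate ξ (decode u)) (size-decode u))))

  near⇒adj : ∀ ξ u {v} → v < N → Near ξ (decode u) (decode v) → adj ξ u v ≡ true
  near⇒adj ξ u {v} v<N (inj₁ eq)
    rewrite ≡ᵇ-true (code (fixed (decode u))) v (trans (cong code (sym eq)) (code-decode v<N)) = refl
  near⇒adj ξ u {v} v<N (inj₂ eq)
    rewrite ≡ᵇ-true (code (mate ξ (decode u))) v (trans (cong code (sym eq)) (code-decode v<N)) = Bool.∨-zeroʳ _

  adj-symmetric : ∀ ξ {u v} → u < N → v < N → adj ξ u v ≡ adj ξ v u
  adj-symmetric ξ {u} {v} u<N v<N = true⇔true
    (λ eq → near⇒adj ξ v u<N (near-sym ξ (adj⇒near ξ u v eq)))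
    (λ eq → near⇒adj ξ u v<N (near-sym ξ (adj⇒near ξ v u eq)))

  decode-injective : ∀ {u v} → u < N → v < N → decode u ≡ decode v → u ≡ v
  decode-injective u<N v<N eq = trans (sym (code-decode u<N)) (trans (cong code eq) (code-decode v<N))

  code-injective : ∀ {v w} → size v ≡ r → size w ≡ r → code v ≡ code w → v ≡ w
  code-injective szv szw eq = trans (sym (decode-code _ szv)) (trans (cong decode eq) (decode-code _ szw))

  module _ (ξ : Config) (even : Even ξ) where
    open Ranking ξ r

    rank : Node → ℕ
    rank v = proj₁ (place v) * K + proj₂ (place v)

    ≺⇒< : ∀ {v w} → place v ≺ place w → rank v < rank w
    ≺⇒< {v} {w} v≺w = go v≺w
      where
      go : ∀ {p q} → p ≺ q → proj₁ p * K + proj₂ p < proj₁ q * K + proj₂ q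
      go (within refl x<y) = ℕ.+-monoʳ-< _ x<y
      go (across {b} {x} {b′} {y} b<b′ x<K) = ℕ.<-≤-trans (ℕ.+-monoʳ-< (b * K) x<K)
        (ℕ.≤-trans (ℕ.≤-reflexive (ℕ.+-comm (b * K) K)) (ℕ.≤-trans (ℕ.*-monoˡ-≤ K b<b′) (ℕ.m≤m+n (b′ * K) y)))

    near-distinct : ∀ {v w} → size v ≡ r → Near ξ v w → v ≢ w → rank v ≢ rank w
    near-distinct {v} sz near v≢w eq with kind v
    near-distinct sz (inj₁ refl) v≢w eq | is-start with refl ← sz = ℕ.<⇒≢ (≺⇒< {start r} {rP 0 r} start-flow) eq
    near-distinct {start e} sz (inj₂ refl) v≢w eq | is-start = v≢w (sym (mate-start ξ e))
    near-distinct sz (inj₁ refl) v≢w eq | is-end with refl ← sz = ℕ.<⇒≢ (≺⇒< {fixed (end r)} {end r} end-flow) (sym eq)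
    near-distinct {end i} sz (inj₂ refl) v≢w eq | is-end = v≢w (sym (mate-end ξ i))
    ... | is-inside ins with flow even v sz ins | near
    ...   | inj₁ (f<v , v<m) | inj₁ refl = ℕ.<⇒≢ (≺⇒< {fixed v} {v} f<v) (sym eq)
    ...   | inj₁ (f<v , v<m) | inj₂ refl = ℕ.<⇒≢ (≺⇒< {v} {mate ξ v} v<m) eq
    ...   | inj₂ (m<v , v<f) | inj₁ refl = ℕ.<⇒≢ (≺⇒< {v} {fixed v} v<f) eq
    ...   | inj₂ (m<v , v<f) | inj₂ refl = ℕ.<⇒≢ (≺⇒< {mate ξ v} {v} m<v) (sym eq)

    near-unique : ∀ {v w x} → size v ≡ r → Near ξ v w → Near ξ v x → v ≢ w → v ≢ x →
      rank w < rank v → rank x < rank v → w ≡ x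
    near-unique sz (inj₁ refl) (inj₁ refl) _ _ _ _ = refl
    near-unique sz (inj₂ refl) (inj₂ refl) _ _ _ _ = refl
    near-unique sz (inj₂ refl) (inj₁ refl) v≢w v≢x w<v x<v =
      sym (near-unique sz (inj₁ refl) (inj₂ refl) v≢x v≢w x<v w<v)
    near-unique {v} sz (inj₁ refl) (inj₂ refl) v≢w v≢x w<v x<v with kind v
    near-unique {start e} sz (inj₁ refl) (inj₂ refl) v≢w v≢x w<v x<v | is-start = ⊥-elim (v≢x (sym (mate-start ξ e)))
    near-unique {end i} sz (inj₁ refl) (inj₂ refl) v≢w v≢x w<v x<v | is-end = ⊥-elim (v≢x (sym (mate-end ξ i)))
    ... | is-inside ins with flow even v sz ins
    ...   | inj₁ (_ , v<m) = ⊥-elim (ℕ.<-asym x<v (≺⇒< {v} {mate ξ v} v<m))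
    ...   | inj₂ (_ , v<f) = ⊥-elim (ℕ.<-asym w<v (≺⇒< {v} {fixed v} v<f))

    near-lower : ∀ v → size v ≡ r → v ≡ start r ⊎ ∃ λ w → Near ξ v w × rank w < rank v
    near-lower v sz with kind v
    near-lower _ refl | is-start = inj₁ refl
    near-lower _ refl | is-end   = inj₂ (_ , inj₁ refl , ≺⇒< {fixed (end r)} {end r} end-flow)
    ... | is-inside ins with flow even v sz ins
    ...   | inj₁ (f<v , _) = inj₂ (_ , inj₁ refl , ≺⇒< {fixed v} {v} f<v)
    ...   | inj₂ (m<v , _) = inj₂ (_ , inj₂ refl , ≺⇒< {mate ξ v} {v} m<v)

    module _ (k′ n : ℕ) (N*K≤n : N * suc k′ ≤ n) where
      open Extend N k′ n N*K≤n

      -- Code 0 belongs to `start r`, its own mate: the single entry leaves room for the further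
      -- path hanging there.
      nbrs : ℕ → List ℕ
      nbrs zero    = code (fixed (start r)) ∷ []
      nbrs (suc u) = code (fixed (decode (suc u))) ∷ code (mate ξ (decode (suc u))) ∷ []

      nbrs-all : ∀ {u v} → u < N → v < N → u ≢ v → adj ξ u v ≡ true → v ∈ nbrs u
      nbrs-all {u} {v} u<N v<N u≢v a with adj⇒near ξ u v a
      nbrs-all {zero}  _ v<N _ _ | inj₁ eq = head (trans (sym (code-decode v<N)) (cong code eq))
      nbrs-all {suc u} _ v<N _ _ | inj₁ eq = head (trans (sym (code-decode v<N)) (cong code eq))
      nbrs-all {zero}  u<N v<N u≢v _ | inj₂ eq = ⊥-elim (u≢v (decode-injective u<N v<N (trans (sym (mate-start ξ r)) (sym eq))))
      nbrs-all {suc u} _ v<N _ _ | inj₂ eq = tail (head (trans (sym (code-decode v<N)) (cong code eq)))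

      adj-spine : Spine (adj ξ)
      adj-spine = record
        { symmetric  = adj-symmetric ξ
        ; nbrs       = nbrs
        ; nbrs-all   = nbrs-all
        ; nbrs-≤2    = λ { zero → s≤s z≤n ; (suc u) → ℕ.≤-refl }
        ; nbrs₀-≤1   = ℕ.≤-refl
        ; rank       = λ u → rank (decode u)
        ; bound      = supremum (λ u → rank (decode u)) N
        ; rank<bound = <-supremum (λ u → rank (decode u))
        ; distinct   = λ {u} {v} u<N v<N u≢v a → near-distinct (size-decode u) (adj⇒near ξ u v a) (λ eq → u≢v (decode-injective u<N v<N eq))
        ; unique     = λ {u} {v} {w} u<N v<N w<N u≢v u≢w a b v<u w<u → decode-injective v<N w<N
            (near-unique (size-decode u) (adj⇒near ξ u v a) (adj⇒near ξ u w b)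
              (λ eq → u≢v (decode-injective u<N v<N eq)) (λ eq → u≢w (decode-injective u<N w<N eq)) v<u w<u)
        ; lower      = lower
        }
        where
        lower : ∀ {u} → u < N → u ≡ 0 ⊎ ∃ λ v → v < N × u ≢ v × adj ξ u v ≡ true × rank (decode v) < rank (decode u)
        lower {u} u<N with near-lower (decode u) (size-decode u)
        ... | inj₁ eq = inj₁ (trans (sym (code-decode u<N)) (cong code eq))
        ... | inj₂ (w , near , w<u) = inj₂ (code w , cw<N , u≢ , near⇒adj ξ u cw<N (subst (Near ξ (decode u)) (sym dw) near)
                                          , subst (λ x → rank x < rank (decode u)) (sym dw) w<u)
          where
          szw : size w ≡ r
          szw = size-near ξ near (size-decode u)
          cw<N = code<N w szw
          dw = decode-code w szw
          u≢ : u ≢ code w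
          u≢ eq = ℕ.<-irrefl (cong rank (trans (sym dw) (cong decode (sym eq)))) w<u

-- Trees between two given ones

module ThreeLeaves {A : Set} (_≟_ : (x y : A) → Dec (x ≡ y)) (R : A → A → Set) (R-sym : ∀ {x y} → R x y → R y x)
  (deg≤2 : ∀ {x a b c} → R x a → R x b → R x c → a ≢ b → a ≢ c → b ≢ c → ⊥) where

  -- A walk without backtracking from `c` to its index, `p` being the vertex visited just before
  -- `c`.
  data Onward (p c : A) : A → Set where
    stop : Onward p c c
    go   : ∀ {n w} → R c n → n ≢ p → Onward c n w → Onward p c w

  reduce : ∀ {x w} → Star R x w → x ≡ w ⊎ ∃ λ n → R x n × Onward x n w
  reduce ε = inj₁ refl
  reduce {x} (e ◅ walk) with reduce walk
  ... | inj₁ refl = inj₂ (_ , e , stop)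
  ... | inj₂ (n , f , rest) with n ≟ x
  ...   | no n≢x = inj₂ (_ , e , go f n≢x rest)
  ...   | yes refl with rest
  ...     | stop = inj₁ refl
  ...     | go g _ rest′ = inj₂ (_ , g , rest′)

  Leaf : A → Set
  Leaf x = ∀ {a b} → R x a → R x b → a ≡ b

  -- In degree at most two there is only one way on from `c` other than back to `p`, so two such
  -- walks run together until one stops. It stops at a leaf, which the other walk then cannot leave.
  onward-unique : ∀ {p c q s} → R p c → Leaf q → Leaf s → q ≢ s → Onward p c q → Onward p c s → ⊥
  onward-unique e lq ls q≢s stop stop = q≢s refl
  onward-unique e lq ls q≢s stop (go f n≢p _) = n≢p (lq f (R-sym e))
  onward-unique e lq ls q≢s (go f n≢p _) stop = n≢p (ls f (R-sym e))
  onward-unique e lq ls q≢s (go {n = n} f n≢p w) (go {n = m} g m≢p w′) with n ≟ m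
  ... | yes refl = onward-unique f lq ls q≢s w w′
  ... | no n≢m   = deg≤2 (R-sym e) f g (≢-sym n≢p) (≢-sym m≢p) n≢m

  -- Walks without backtracking from one leaf are determined by their length, so they cannot reach two other leaves.
  no-three-leaves : ∀ {p q s} → Leaf p → Leaf q → Leaf s → p ≢ q → p ≢ s → q ≢ s → Star R p q → Star R p s → ⊥
  no-three-leaves lp lq ls p≢q p≢s q≢s pq ps with reduce pq | reduce ps
  ... | inj₁ p≡q | _ = p≢q p≡q
  ... | inj₂ _ | inj₁ p≡s = p≢s p≡s
  ... | inj₂ (n , e , w) | inj₂ (m , f , w′) with lp e f
  ...   | refl = onward-unique e lq ls q≢s w w′

-- The closed circuit through the edge c₂a₄ in a cell with odd parity; the indices are the modes of row and column.
data Loop : Bool → Bool → Port → Set where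
  oo-c₂ : Loop false false c₂
  oo-a₄ : Loop false false a₄
  oo-a₅ : Loop false false a₅
  oo-b₄ : Loop false false b₄
  oo-b₅ : Loop false false b₅
  oo-c₃ : Loop false false c₃
  io-c₂ : Loop true false c₂
  io-a₄ : Loop true false a₄
  io-a₃ : Loop true false a₃
  io-b₂ : Loop true false b₂
  io-b₃ : Loop true false b₃
  io-c₁ : Loop true false c₁
  oi-c₂ : Loop false true c₂
  oi-a₄ : Loop false true a₄
  oi-a₅ : Loop false true a₅
  oi-b₄ : Loop false true b₄
  oi-b₃ : Loop false true b₃
  oi-c₁ : Loop false true c₁
  ii-c₂ : Loop true true c₂
  ii-a₄ : Loop true true a₄
  ii-a₃ : Loop true true a₃
  ii-b₂ : Loop true true b₂
  ii-b₁ : Loop true true b₁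
  ii-b₆ : Loop true true b₆
  ii-b₅ : Loop true true b₅
  ii-c₃ : Loop true true c₃

-- With odd parity the strand leaves by `c₄` on its first pass. Both edges at every vertex of the
-- other lane, `c₂` and `a₄` included, then lead to vertices of the same circuit, so no walk can
-- leave it.
loop-closed : ∀ ξ j d e {p q g} → ξ (row e) ≡ p → ξ (col j) ≡ q → ξ (local j d e) ≡ not (p xor q) → Loop p q g →
  (∃ λ h → Loop p q h × fixed (cell g j d e) ≡ cell h j d e) × (∃ λ h → Loop p q h × mate ξ (cell g j d e) ≡ cell h j d e)
loop-closed ξ j d e eqr eqc eql oo-c₂ rewrite eql = (_ , oo-a₄ , refl) , (_ , oo-c₃ , refl)
loop-closed ξ j d e eqr eqc eql oo-a₄ rewrite eqr = (_ , oo-c₂ , refl) , (_ , oo-a₅ , refl)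
loop-closed ξ j d e eqr eqc eql oo-a₅ rewrite eqr = (_ , oo-b₄ , refl) , (_ , oo-a₄ , refl)
loop-closed ξ j d e eqr eqc eql oo-b₄ rewrite eqc = (_ , oo-a₅ , refl) , (_ , oo-b₅ , refl)
loop-closed ξ j d e eqr eqc eql oo-b₅ rewrite eqc = (_ , oo-c₃ , refl) , (_ , oo-b₄ , refl)
loop-closed ξ j d e eqr eqc eql oo-c₃ rewrite eql = (_ , oo-b₅ , refl) , (_ , oo-c₂ , refl)
loop-closed ξ j d e eqr eqc eql io-c₂ rewrite eql = (_ , io-a₄ , refl) , (_ , io-c₁ , refl)
loop-closed ξ j d e eqr eqc eql io-a₄ rewrite eqr = (_ , io-c₂ , refl) , (_ , io-a₃ , refl)
loop-closed ξ j d e eqr eqc eql io-a₃ rewrite eqr = (_ , io-b₂ , refl) , (_ , io-a₄ , refl)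
loop-closed ξ j d e eqr eqc eql io-b₂ rewrite eqc = (_ , io-a₃ , refl) , (_ , io-b₃ , refl)
loop-closed ξ j d e eqr eqc eql io-b₃ rewrite eqc = (_ , io-c₁ , refl) , (_ , io-b₂ , refl)
loop-closed ξ j d e eqr eqc eql io-c₁ rewrite eql = (_ , io-b₃ , refl) , (_ , io-c₂ , refl)
loop-closed ξ j d e eqr eqc eql oi-c₂ rewrite eql = (_ , oi-a₄ , refl) , (_ , oi-c₁ , refl)
loop-closed ξ j d e eqr eqc eql oi-a₄ rewrite eqr = (_ , oi-c₂ , refl) , (_ , oi-a₅ , refl)
loop-closed ξ j d e eqr eqc eql oi-a₅ rewrite eqr = (_ , oi-b₄ , refl) , (_ , oi-a₄ , refl)
loop-closed ξ j d e eqr eqc eql oi-b₄ rewrite eqc = (_ , oi-a₅ , refl) , (_ , oi-b₃ , refl)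
loop-closed ξ j d e eqr eqc eql oi-b₃ rewrite eqc = (_ , oi-c₁ , refl) , (_ , oi-b₄ , refl)
loop-closed ξ j d e eqr eqc eql oi-c₁ rewrite eql = (_ , oi-b₃ , refl) , (_ , oi-c₂ , refl)
loop-closed ξ j d e eqr eqc eql ii-c₂ rewrite eql = (_ , ii-a₄ , refl) , (_ , ii-c₃ , refl)
loop-closed ξ j d e eqr eqc eql ii-a₄ rewrite eqr = (_ , ii-c₂ , refl) , (_ , ii-a₃ , refl)
loop-closed ξ j d e eqr eqc eql ii-a₃ rewrite eqr = (_ , ii-b₂ , refl) , (_ , ii-a₄ , refl)
loop-closed ξ j d e eqr eqc eql ii-b₂ rewrite eqc = (_ , ii-a₃ , refl) , (_ , ii-b₁ , refl)
loop-closed ξ j d e eqr eqc eql ii-b₁ rewrite eqc = (_ , ii-b₆ , refl) , (_ , ii-b₂ , refl)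
loop-closed ξ j d e eqr eqc eql ii-b₆ rewrite eqc = (_ , ii-b₁ , refl) , (_ , ii-b₅ , refl)
loop-closed ξ j d e eqr eqc eql ii-b₅ rewrite eqc = (_ , ii-c₃ , refl) , (_ , ii-b₆ , refl)
loop-closed ξ j d e eqr eqc eql ii-c₃ rewrite eql = (_ , ii-b₅ , refl) , (_ , ii-c₂ , refl)

loop-c₂ : ∀ p q → Loop p q c₂
loop-c₂ false false = oo-c₂
loop-c₂ true  false = io-c₂
loop-c₂ false true  = oi-c₂
loop-c₂ true  true  = ii-c₂

outer-inside : ∀ {v} → Inside v → Inside (outer v)
outer-inside {v} ins = go (outer-involutive v) (kind (outer v)) ins
  where
  go : ∀ {v w} → outer w ≡ v → Kind w → Inside v → Inside w
  go _    (is-inside ins) _ = ins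
  go refl is-start ()
  go refl is-end   ()

v≢inner : ∀ {v} → Inside v → v ≢ inner v
v≢inner {rP i e} _ = λ ()
v≢inner {rQ i e} _ = λ ()
v≢inner {cP i e} _ = λ ()
v≢inner {cQ i e} _ = λ ()
v≢inner {cell a₁ j d e} _ = λ ()
v≢inner {cell a₂ j d e} _ = λ ()
v≢inner {cell a₃ j d e} _ = λ ()
v≢inner {cell a₄ j d e} _ = λ ()
v≢inner {cell a₅ j d e} _ = λ ()
v≢inner {cell a₆ j d e} _ = λ ()
v≢inner {cell b₁ j d e} _ = λ ()
v≢inner {cell b₂ j d e} _ = λ ()
v≢inner {cell b₃ j d e} _ = λ ()
v≢inner {cell b₄ j d e} _ = λ ()
v≢inner {cell b₅ j d e} _ = λ ()
v≢inner {cell b₆ j d e} _ = λ ()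
v≢inner {cell c₁ j d e} _ = λ ()
v≢inner {cell c₂ j d e} _ = λ ()
v≢inner {cell c₃ j d e} _ = λ ()
v≢inner {cell c₄ j d e} _ = λ ()

v≢outer : ∀ {v} → Inside v → v ≢ outer v
v≢outer {rP i e} _ = λ ()
v≢outer {rQ i e} _ = λ ()
v≢outer {cP i e} _ = λ ()
v≢outer {cQ i e} _ = λ ()
v≢outer {cell a₁ zero d e} _ = λ ()
v≢outer {cell a₁ (suc j) d e} _ = λ ()
v≢outer {cell a₂ j d e} _ = λ ()
v≢outer {cell a₃ j d e} _ = λ ()
v≢outer {cell a₄ j d e} _ = λ ()
v≢outer {cell a₅ j d e} _ = λ ()
v≢outer {cell a₆ j zero e} _ = λ ()
v≢outer {cell a₆ j (suc d) e} _ = λ ()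
v≢outer {cell b₁ j zero e} _ = λ ()
v≢outer {cell b₁ j (suc d) e} _ = λ ()
v≢outer {cell b₂ j d e} _ = λ ()
v≢outer {cell b₃ j d e} _ = λ ()
v≢outer {cell b₄ j d e} _ = λ ()
v≢outer {cell b₅ j d e} _ = λ ()
v≢outer {cell b₆ j d zero} _ = λ ()
v≢outer {cell b₆ j d (suc e)} _ = λ ()
v≢outer {cell c₁ j d e} _ = λ ()
v≢outer {cell c₂ j d e} _ = λ ()
v≢outer {cell c₃ j d e} _ = λ ()
v≢outer {cell c₄ j d e} _ = λ ()

-- The modes of an intermediate graph

module Analysis (r : ℕ) (k′ n : ℕ) (N*K≤n : Coding.N r * suc k′ ≤ n) where
  open Track-graph r
  open Extend N k′ n N*K≤n

  module _ (ξ₁ ξ₂ : Config) (Z : ℕ → ℕ → Bool) (T : Trace (adj ξ₁) (adj ξ₂) Z) where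
    open Trace T

    -- Ok and _—_ are records rather than synonyms so that their nodes can be inferred.
    record Ok (v : Node) : Set where
      constructor ok
      field
        size≡r : size v ≡ r

      code< : code v < N
      code< = code<N v size≡r

      decoded : decode (code v) ≡ v
      decoded = decode-code v size≡r
    open Ok

    record _—_ (v w : Node) : Set where
      constructor edge
      field
        present : Z (code v) (code w) ≡ true
    open _—_

    ok-start : Ok (start r)
    ok-start = ok refl

    ok-end : Ok (end r)
    ok-end = ok refl

    ok-decode : ∀ u → Ok (decode u)
    ok-decode u = ok (size-decode u)

    ok-fixed : ∀ {v} → Ok v → Ok (fixed v)
    ok-fixed {v} (ok sz) = ok (trans (size-fixed v) sz)

    ok-inner : ∀ {v} → Ok v → Ok (inner v)
    ok-inner {v} (ok sz) = ok (trans (size-inner v) sz)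

    ok-outer : ∀ {v} → Ok v → Ok (outer v)
    ok-outer {v} (ok sz) = ok (trans (size-outer v) sz)

    code-≢ : ∀ {v w} → Ok v → Ok w → v ≢ w → code v ≢ code w
    code-≢ okv okw v≢w eq = v≢w (code-injective (size≡r okv) (size≡r okw) eq)

    near : ∀ ξ {v w} → Ok v → Ok w → Near ξ v w → adj ξ (code v) (code w) ≡ true
    near ξ {v} okv okw nr = near⇒adj ξ (code v) (code< okw)
      (subst₂ (Near ξ) (sym (decoded okv)) (sym (decoded okw)) nr)

    mate-cases : ∀ ξ v → mate ξ v ≡ inner v ⊎ mate ξ v ≡ outer v
    mate-cases ξ v with ξ (track v)
    ... | true  = inj₁ refl
    ... | false = inj₂ refl

    —-shared : ∀ {v w} → Ok v → Ok w → v ≢ w → Near ξ₁ v w → Near ξ₂ v w → v — w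
    —-shared okv okw v≢w near₁ near₂ = edge (⊇∩ (code< okv) (code< okw) (code-≢ okv okw v≢w)
      (near ξ₁ okv okw near₁) (near ξ₂ okv okw near₂))

    —-fixed : ∀ {v} → Ok v → v — fixed v
    —-fixed {v} okv = —-shared okv (ok-fixed okv) (v≢fixed v) (inj₁ refl) (inj₁ refl)

    —-cases : ∀ {v w} → Ok v → Ok w → v — w → w ≡ fixed v ⊎ w ≡ inner v ⊎ w ≡ outer v
    —-cases {v} {w} okv okw (edge e) = [ from ξ₁ , from ξ₂ ]′ (⊆∪ (code< okv) (code< okw) e)
      where
      from : ∀ ξ → adj ξ (code v) (code w) ≡ true → w ≡ fixed v ⊎ w ≡ inner v ⊎ w ≡ outer v
      from ξ a with subst₂ (Near ξ) (decoded okv) (decoded okw) (adj⇒near ξ (code v) (code w) a)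
      ... | inj₁ eq = inj₁ eq
      ... | inj₂ eq = inj₂ (⊎.map (trans eq) (trans eq) (mate-cases ξ v))

    -- The fixed edge is common to both given paths and hence present; with both other edges the
    -- degree would be three.
    not-both : ∀ {v} → Ok v → Inside v → v — inner v → v — outer v → ⊥
    not-both {v} okv ins (edge i) (edge o) =
      degree≤2 (code< okv) (code< (ok-fixed okv)) (code< (ok-inner okv)) (code< (ok-outer okv))
        (code-≢ (ok-fixed okv) (ok-inner okv) (fixed≢inner v)) (code-≢ (ok-fixed okv) (ok-outer okv) (fixed≢outer v))
        (code-≢ (ok-inner okv) (ok-outer okv) (inner≢outer ins)) (present (—-fixed okv)) i o

    —-irreflexive : ∀ {v} → v — v → ⊥
    —-irreflexive {v} (edge e) with () ← trans (sym (irreflexive (code v))) e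

    Step-sym : ∀ {u v} → Step Z u v → Step Z v u
    Step-sym {u} {v} (u<N , v<N , e) = v<N , u<N , trans (symmetric v u) e

    Step-degree≤2 : ∀ {u a b c} → Step Z u a → Step Z u b → Step Z u c → a ≢ b → a ≢ c → b ≢ c → ⊥
    Step-degree≤2 (u<N , a<N , ua) (_ , b<N , ub) (_ , c<N , uc) a≢b a≢c b≢c =
      degree≤2 u<N a<N b<N c<N a≢b a≢c b≢c ua ub uc

    module Leaves = ThreeLeaves ℕ._≟_ (Step Z) Step-sym Step-degree≤2

    is-leaf : ∀ {v} → (∀ {w} → Ok w → v — w → w ≡ fixed v) → Leaves.Leaf (code v)
    is-leaf {v} only {a} {b} (_ , a<N , ea) (_ , b<N , eb) = decode-injective a<N b<N (trans (hits a<N ea) (sym (hits b<N eb)))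
      where
      hits : ∀ {a} → a < N → Z (code v) a ≡ true → decode a ≡ fixed v
      hits {a} a<N e = only (ok-decode a) (edge (subst (λ x → Z (code v) x ≡ true) (sym (code-decode a<N)) e))

    fixed-only : ∀ {v w} → Ok v → Ok w → inner v ≡ v → outer v ≡ v → v — w → w ≡ fixed v
    fixed-only {v} okv okw iv ov e with —-cases okv okw e
    ... | inj₁ eq = eq
    ... | inj₂ (inj₁ eq) = ⊥-elim (—-irreflexive (subst (v —_) (trans eq iv) e))
    ... | inj₂ (inj₂ eq) = ⊥-elim (—-irreflexive (subst (v —_) (trans eq ov) e))

    start-only : ∀ {w} → Ok w → start r — w → w ≡ fixed (start r)
    start-only okw = fixed-only ok-start okw refl refl

    end-only : ∀ {w} → Ok w → end r — w → w ≡ fixed (end r)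
    end-only okw = fixed-only ok-end okw refl refl

    -- Otherwise `v` would keep only its fixed edge and be a third leaf besides `start r` and
    -- `end r`, impossible in a connected graph of maximum degree two.
    not-neither : ∀ {v} → Ok v → Inside v → ¬ v — inner v → ¬ v — outer v → ⊥
    not-neither {v} okv ins ¬i ¬o = Leaves.no-three-leaves
      (is-leaf start-only) (is-leaf end-only) (is-leaf only)
      (λ ()) (code-≢ ok-start okv λ { refl → case ins of λ () }) (code-≢ ok-end okv λ { refl → case ins of λ () })
      (connected (code< ok-start) (code< ok-end)) (connected (code< ok-start) (code< okv))
      where
      only : ∀ {w} → Ok w → v — w → w ≡ fixed v
      only okw e with —-cases okv okw e
      ... | inj₁ eq = eq
      ... | inj₂ (inj₁ refl) = ⊥-elim (¬i e)
      ... | inj₂ (inj₂ refl) = ⊥-elim (¬o e)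

    mode : Node → Bool
    mode v = Z (code v) (code (inner v))

    mode-outer-edge : ∀ {v} → Ok v → Inside v → mode v ≡ not (Z (code v) (code (outer v)))
    mode-outer-edge {v} okv ins with Z (code v) (code (inner v)) in i | Z (code v) (code (outer v)) in o
    ... | true  | true  = ⊥-elim (not-both okv ins (edge i) (edge o))
    ... | true  | false = refl
    ... | false | true  = refl
    ... | false | false = ⊥-elim (not-neither okv ins (λ e → Bool.not-¬ i (present e)) (λ e → Bool.not-¬ o (present e)))

    mode-inner : ∀ v → mode (inner v) ≡ mode v
    mode-inner v rewrite inner-involutive v = symmetric (code (inner v)) (code v)

    -- Exactly one of the inner and outer edges is present at a node, so the mode can be read from
    -- the outer edge too, and that edge is shared with the node at its other end. Along an
    -- alternating cycle the mode is therefore constant.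
    mode-outer : ∀ {v} → Ok v → Inside v → mode (outer v) ≡ mode v
    mode-outer {v} okv ins = trans (mode-outer-edge (ok-outer okv) (outer-inside ins))
      (trans (cong not (trans (cong (λ w → Z (code (outer v)) (code w)) (outer-involutive v)) (symmetric (code (outer v)) (code v))))
        (sym (mode-outer-edge okv ins)))

    outer-step : ∀ p j d e → (j + d) + e ≡ r → mode (outer (cell p j d e)) ≡ mode (cell p j d e)
    outer-step p j d e sz = mode-outer {cell p j d e} (ok sz) inside-cell

    along-a : ∀ j d e → (j + d) + e ≡ r → mode (cell a₆ j d e) ≡ mode (cell a₁ j d e)
    along-a j d e sz = trans (mode-inner (cell a₅ j d e)) (trans (outer-step a₄ j d e sz)
      (trans (mode-inner (cell a₃ j d e)) (trans (outer-step a₂ j d e sz) (mode-inner (cell a₁ j d e)))))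

    along-b : ∀ j d e → (j + d) + e ≡ r → mode (cell b₆ j d e) ≡ mode (cell b₁ j d e)
    along-b j d e sz = trans (mode-inner (cell b₅ j d e)) (trans (outer-step b₄ j d e sz)
      (trans (mode-inner (cell b₃ j d e)) (trans (outer-step b₂ j d e sz) (mode-inner (cell b₁ j d e)))))

    -- Follows the track backwards from cell `j` to the cap `rP`: an outer edge between neighbouring
    -- cells, then across the switch of the earlier cell.
    along-row : ∀ j d e → (j + d) + e ≡ r → mode (cell a₁ j d e) ≡ mode (rP (j + d) e)
    along-row zero    d e sz = sym (outer-step a₁ zero d e sz)
    along-row (suc j) d e sz = trans (sym (outer-step a₁ (suc j) d e sz)) (trans (along-a j (suc d) e sz′)
      (trans (along-row j (suc d) e sz′) (cong (λ i → mode (rP i e)) (ℕ.+-suc j d))))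
      where sz′ = trans (cong (_+ e) (ℕ.+-suc j d)) sz

    along-col : ∀ j d e → (j + d) + e ≡ r → mode (cell b₁ j d e) ≡ mode (cP j (d + e))
    along-col j zero    e sz = sym (outer-step b₁ j zero e sz)
    along-col j (suc d) e sz = trans (sym (outer-step b₁ j (suc d) e sz)) (trans (along-b j d (suc e) sz′)
      (trans (along-col j d (suc e) sz′) (cong (λ i → mode (cP j i)) (ℕ.+-suc d e))))
      where sz′ = trans (ℕ.+-suc (j + d) e) (trans (cong (_+ e) (sym (ℕ.+-suc j d))) sz)

    -- The configuration that `Z` realises. Each mode is read at one representative, for rows and
    -- columns the first cap, completed to size `r`.
    ζ : Config
    ζ (row e)       = mode (rP (r ∸ e) e)
    ζ (col j)       = mode (cP j (r ∸ j))
    ζ (local j d e) = mode (cell c₁ j d e)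

    row-end : ∀ i e → i + e ≡ r → mode (rP i e) ≡ ζ (row e)
    row-end i e sz = cong (λ m → mode (rP m e)) (trans (sym (ℕ.m+n∸n≡m i e)) (cong (_∸ e) sz))

    col-end : ∀ j e → j + e ≡ r → mode (cP j e) ≡ ζ (col j)
    col-end j e sz = cong (λ m → mode (cP j m)) (trans (sym (ℕ.m+n∸m≡n j e)) (cong (_∸ j) sz))

    row-mode : ∀ j d e → (j + d) + e ≡ r → mode (cell a₁ j d e) ≡ ζ (row e)
    row-mode j d e sz = trans (along-row j d e sz) (row-end (j + d) e sz)

    col-mode : ∀ j d e → (j + d) + e ≡ r → mode (cell b₁ j d e) ≡ ζ (col j)
    col-mode j d e sz = trans (along-col j d e sz) (col-end j (d + e) (trans (sym (ℕ.+-assoc j d e)) sz))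

    mode-ζ : ∀ v → size v ≡ r → Inside v → mode v ≡ ζ (track v)
    mode-ζ (rP i e) sz _ = row-end i e sz
    mode-ζ (rQ i e) sz _ = trans (mode-inner (rP i e)) (row-end i e sz)
    mode-ζ (cP j e) sz _ = col-end j e sz
    mode-ζ (cQ j e) sz _ = trans (mode-inner (cP j e)) (col-end j e sz)
    mode-ζ (cell p j d e) sz _ = ports p
      where
      at₁ = row-mode j d e sz
      at₂ = trans (mode-inner (cell a₁ j d e)) at₁
      at₃ = trans (outer-step a₂ j d e sz) at₂
      at₆ = trans (along-a j d e sz) at₁
      bt₁ = col-mode j d e sz
      bt₂ = trans (mode-inner (cell b₁ j d e)) bt₁
      bt₃ = trans (outer-step b₂ j d e sz) bt₂
      bt₆ = trans (along-b j d e sz) bt₁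
      ports : ∀ p → mode (cell p j d e) ≡ ζ (track (cell p j d e))
      ports a₁ = at₁
      ports a₂ = at₂
      ports a₃ = at₃
      ports a₄ = trans (mode-inner (cell a₃ j d e)) at₃
      ports a₅ = trans (sym (mode-inner (cell a₅ j d e))) at₆
      ports a₆ = at₆
      ports b₁ = bt₁
      ports b₂ = bt₂
      ports b₃ = bt₃
      ports b₄ = trans (mode-inner (cell b₃ j d e)) bt₃
      ports b₅ = trans (sym (mode-inner (cell b₅ j d e))) bt₆
      ports b₆ = bt₆
      ports c₁ = refl
      ports c₂ = outer-step c₁ j d e sz
      ports c₃ = trans (mode-inner (cell c₂ j d e)) (outer-step c₁ j d e sz)
      ports c₄ = mode-inner (cell c₁ j d e)

    ζ-mode : ∀ {v} → Ok v → Inside v → mode v ≡ ζ (track v)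
    ζ-mode {v} (ok sz) = mode-ζ v sz

    outer-edge : ∀ {v} → Ok v → Inside v → mode v ≡ false → v — outer v
    outer-edge okv ins eq = edge (trans (sym (Bool.not-involutive _)) (cong not (trans (sym (mode-outer-edge okv ins)) eq)))

    —-mate : ∀ {v} → Ok v → Inside v → v — mate ζ v
    —-mate {v} okv ins with ζ (track v) | ζ-mode okv ins
    ... | true  | eq = edge eq
    ... | false | eq = outer-edge okv ins eq

    —-near : ∀ {v w} → Ok v → Ok w → Inside v → v — w → Near ζ v w
    —-near {v} okv okw ins e with —-cases okv okw e
    ... | inj₁ eq = inj₁ eq
    ... | inj₂ (inj₁ refl) with ζ (track v) | —-mate okv ins
    ...   | true  | _ = inj₂ refl
    ...   | false | o = ⊥-elim (not-both okv ins e o)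
    —-near {v} okv okw ins e | inj₂ (inj₂ refl) with ζ (track v) | —-mate okv ins
    ...   | true  | i = ⊥-elim (not-both okv ins i e)
    ...   | false | _ = inj₂ refl

    -- With the wrong parity a walk from `c₂` of this cell to `start r`, whose code is 0, would have
    -- to leave a closed circuit.
    ζ-even : ∀ j d e → (j + d) + e ≡ r → ζ (local j d e) ≡ ζ (row e) xor ζ (col j)
    ζ-even j d e sz with ζ (local j d e) Bool.≟ (ζ (row e) xor ζ (col j))
    ... | yes eq = eq
    ... | no neq = ⊥-elim (escape (connected (code<N (cell c₂ j d e) sz) (code< ok-start))
                    (c₂ , loop-c₂ _ _ , decode-code (cell c₂ j d e) sz))
      where
      OnLoop : ℕ → Set
      OnLoop u = ∃ λ g → Loop (ζ (row e)) (ζ (col j)) g × decode u ≡ cell g j d e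
      closed : ∀ {u v} → OnLoop u → Step Z u v → OnLoop v
      closed {u} {v} (g , lp , eq) (u<N , v<N , uv)
        with loop-closed ζ j d e refl refl (Bool.¬-not neq) lp
           | —-near (ok-decode u) (ok-decode v) (subst Inside (sym eq) inside-cell)
               (edge (subst₂ (λ x y → Z x y ≡ true) (sym (code-decode u<N)) (sym (code-decode v<N)) uv))
      ... | (h , lh , f) , _ | inj₁ nr = h , lh , trans nr (trans (cong fixed eq) f)
      ... | _ , (h , lh , m) | inj₂ nr = h , lh , trans nr (trans (cong (mate ζ) eq) m)
      escape : ∀ {u} → Star (Step Z) u 0 → OnLoop u → ⊥
      escape ε (_ , _ , ())
      escape (s ◅ walk) l = escape walk (closed l s)

    -- A mode shared by `ξ₁` and `ξ₂` makes the corresponding edge at `v` common to both paths,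
    -- hence an edge of `Z`.
    ζ-between : ∀ {v} → Ok v → Inside v → ∀ b → ξ₁ (track v) ≡ b → ξ₂ (track v) ≡ b → ζ (track v) ≡ b
    ζ-between {v} okv ins true eq₁ eq₂ = trans (sym (ζ-mode okv ins)) (present
      (—-shared okv (ok-inner okv) (v≢inner ins)
        (inj₂ (sym (cong (λ b → if b then inner v else outer v) eq₁)))
        (inj₂ (sym (cong (λ b → if b then inner v else outer v) eq₂)))))
    ζ-between {v} okv ins false eq₁ eq₂ = trans (sym (ζ-mode okv ins)) (trans (mode-outer-edge okv ins) (cong not (present
      (—-shared okv (ok-outer okv) (v≢outer ins)
        (inj₂ (sym (cong (λ b → if b then inner v else outer v) eq₁)))
        (inj₂ (sym (cong (λ b → if b then inner v else outer v) eq₂)))))))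

    mate-≡ : ∀ ξ → (∀ v → Ok v → Inside v → ζ (track v) ≡ ξ (track v)) → ∀ {v} → Ok v → Kind v → mate ζ v ≡ mate ξ v
    mate-≡ ξ ζ≡ξ _ (is-start {e}) = trans (mate-start ζ e) (sym (mate-start ξ e))
    mate-≡ ξ ζ≡ξ _ (is-end {i})   = trans (mate-end ζ i) (sym (mate-end ξ i))
    mate-≡ ξ ζ≡ξ {v} okv (is-inside ins) = cong (λ b → if b then inner v else outer v) (ζ≡ξ v okv ins)

    —⇒near : ∀ {v w} → Ok v → Ok w → Kind v → v — w → Near ζ v w
    —⇒near (ok refl) okw is-start   e = inj₁ (start-only okw e)
    —⇒near (ok refl) okw is-end     e = inj₁ (end-only okw e)
    —⇒near okv  okw (is-inside ins) e = —-near okv okw ins e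

    near⇒— : ∀ {v w} → Ok v → Kind v → v ≢ w → Near ζ v w → v — w
    near⇒— okv _ _ (inj₁ refl) = —-fixed okv
    near⇒— okv (is-start {e}) v≢w (inj₂ refl) = ⊥-elim (v≢w (sym (mate-start ζ e)))
    near⇒— okv (is-end {i}) v≢w (inj₂ refl)   = ⊥-elim (v≢w (sym (mate-end ζ i)))
    near⇒— okv (is-inside ins) _ (inj₂ refl)  = —-mate okv ins

    -- Every edge of `Z` is a fixed edge or an edge to the mate under `ζ`, and conversely, so `Z` is
    -- determined by its modes.
    agree : ∀ ξ → (∀ v → Ok v → Inside v → ζ (track v) ≡ ξ (track v)) → Agree (adj ξ) Z
    agree ξ ζ≡ξ {u} {v} u<N v<N u≢v = true⇔true to from
      where
      oku = ok-decode u
      Zuv : Z (code (decode u)) (code (decode v)) ≡ Z u v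
      Zuv = cong₂ Z (code-decode u<N) (code-decode v<N)
      mates = mate-≡ ξ ζ≡ξ oku (kind (decode u))
      to : Z u v ≡ true → adj ξ u v ≡ true
      to e = near⇒adj ξ u v<N (⊎.map₂ (λ eq → trans eq mates)
        (—⇒near oku (ok-decode v) (kind (decode u)) (edge (trans Zuv e))))
      from : adj ξ u v ≡ true → Z u v ≡ true
      from a = trans (sym Zuv) (present (near⇒— oku (kind (decode u)) (λ eq → u≢v (decode-injective u<N v<N eq))
        (⊎.map₂ (λ eq → trans eq (sym mates)) (adj⇒near ξ u v a))))

-- The clique

track-cell : ∀ (P : Track → Set) j d e → P (row e) → P (col j) → P (local j d e) → ∀ p → P (track (cell p j d e))
track-cell P j d e a b c a₁ = a
track-cell P j d e a b c a₂ = a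
track-cell P j d e a b c a₃ = a
track-cell P j d e a b c a₄ = a
track-cell P j d e a b c a₅ = a
track-cell P j d e a b c a₆ = a
track-cell P j d e a b c b₁ = b
track-cell P j d e a b c b₂ = b
track-cell P j d e a b c b₃ = b
track-cell P j d e a b c b₄ = b
track-cell P j d e a b c b₅ = b
track-cell P j d e a b c b₆ = b
track-cell P j d e a b c c₁ = c
track-cell P j d e a b c c₂ = c
track-cell P j d e a b c c₃ = c
track-cell P j d e a b c c₄ = c

xor-cancelˡ : ∀ a {b c} → a xor b ≡ a xor c → b ≡ c
xor-cancelˡ true  eq = Bool.not-injective eq
xor-cancelˡ false eq = eq

xor-cancelʳ : ∀ a {b c} → b xor a ≡ c xor a → b ≡ c
xor-cancelʳ a {b} {c} eq = xor-cancelˡ a (trans (Bool.xor-comm a b) (trans eq (Bool.xor-comm c a)))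

xor-flip : ∀ {a b c d} → a ≢ c → b ≢ d → a xor b ≡ c xor d
xor-flip {true}  {b} {true}  a≢c _ = ⊥-elim (a≢c refl)
xor-flip {false} {b} {false} a≢c _ = ⊥-elim (a≢c refl)
xor-flip {true}  {b} {false} {d} _ b≢d = sym (Bool.¬-not (≢-sym b≢d))
xor-flip {false} {b} {true}  {d} _ b≢d = Bool.¬-not b≢d

either : ∀ {a b c : Bool} → a ≢ b → c ≡ a ⊎ c ≡ b
either {a} {b} {c} a≢b with c Bool.≟ a
... | yes c≡a = inj₁ c≡a
... | no c≢a  = inj₂ (trans (Bool.¬-not c≢a) (sym (Bool.¬-not (≢-sym a≢b))))

module Family (r : ℕ) where
  open Track-graph r

  -- The local modes are the parities of the two bits that meet, which is exactly what keeps each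
  -- cell free of a circuit.
  config : (ℕ → Bool) → Config
  config X (row e)       = X (r ∸ e)
  config X (col j)       = X j
  config X (local j d e) = X (r ∸ e) xor X j

  config-even : ∀ X → Even (config X)
  config-even X j d e = refl

  row-size : ∀ {i} → i ≤ r → i + (r ∸ i) ≡ r
  row-size = ℕ.m+[n∸m]≡n

  cell-size : ∀ {i j} → j ≤ i → i ≤ r → (j + (i ∸ j)) + (r ∸ i) ≡ r
  cell-size {i} {j} j≤i i≤r = trans (cong (_+ (r ∸ i)) (ℕ.m+[n∸m]≡n j≤i)) (ℕ.m+[n∸m]≡n i≤r)

  -- The edge between the caps of a row exhibits its bit; it serves to tell the trees of two
  -- different strings apart.
  adj-cap : ∀ X {i} → i ≤ r → adj (config X) (code (rP i (r ∸ i))) (code (rQ i (r ∸ i))) ≡ X i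
  adj-cap X {i} i≤r = true⇔true to from
    where
    P = rP i (r ∸ i)
    Q = rQ i (r ∸ i)
    bit : config X (row (r ∸ i)) ≡ X i
    bit = cong X (ℕ.m∸[m∸n]≡n i≤r)
    dP : decode (code P) ≡ P
    dP = decode-code P (row-size i≤r)
    dQ : decode (code Q) ≡ Q
    dQ = decode-code Q (row-size i≤r)
    to : adj (config X) (code P) (code Q) ≡ true → X i ≡ true
    to a with subst₂ (Near (config X)) dP dQ (adj⇒near (config X) (code P) (code Q) a)
    ... | inj₁ eq = ⊥-elim (fixed≢inner P (sym eq))
    ... | inj₂ eq with config X (row (r ∸ i)) | bit
    ...   | true  | b = sym b
    to a | inj₂ () | false | b
    from : X i ≡ true → adj (config X) (code P) (code Q) ≡ true
    from x = near⇒adj (config X) (code P) (code<N Q (row-size i≤r)) (subst₂ (Near (config X)) (sym dP) (sym dQ)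
      (inj₂ (sym (cong (λ b → if b then inner P else outer P) (trans bit x)))))

  module _ (k′ n : ℕ) (N*K≤n : N * suc k′ ≤ n) where
    open Extend N k′ n N*K≤n

    module _ (X Y : ℕ → Bool) (Z : ℕ → ℕ → Bool) (T : Trace (adj (config X)) (adj (config Y)) Z) where
      module A = Analysis r k′ n N*K≤n
      ζ = A.ζ (config X) (config Y) Z T

      rowᶻ colᶻ : ℕ → Bool
      rowᶻ i = ζ (row (r ∸ i))
      colᶻ i = ζ (col i)

      row-between : ∀ {i} → i ≤ r → ∀ b → X i ≡ b → Y i ≡ b → rowᶻ i ≡ b
      row-between {i} i≤r b x y = A.ζ-between (config X) (config Y) Z T {rP i (r ∸ i)} (A.ok (row-size i≤r)) inside-rP b
        (trans (cong X (ℕ.m∸[m∸n]≡n i≤r)) x) (trans (cong Y (ℕ.m∸[m∸n]≡n i≤r)) y)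

      col-between : ∀ {i} → i ≤ r → ∀ b → X i ≡ b → Y i ≡ b → colᶻ i ≡ b
      col-between {i} i≤r b x y = A.ζ-between (config X) (config Y) Z T {cP i (r ∸ i)} (A.ok (row-size i≤r)) inside-cP b x y

      -- Changing both bits preserves their sum, so the local mode of the cell is common to the two
      -- configurations and forced in `Z`. By even parity it is also the sum of the row and column
      -- modes of `Z`.
      coupled : ∀ {i j} → j ≤ i → i ≤ r → X i ≢ Y i → X j ≢ Y j →
        rowᶻ i xor colᶻ j ≡ X i xor X j × rowᶻ i xor colᶻ j ≡ Y i xor Y j
      coupled {i} {j} j≤i i≤r i∈D j∈D = x , trans x flip
        where
        flip : X i xor X j ≡ Y i xor Y j
        flip = xor-flip i∈D j∈D
        sz = cell-size j≤i i≤r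
        r-r-i : ∀ (W : ℕ → Bool) → W (r ∸ (r ∸ i)) xor W j ≡ W i xor W j
        r-r-i W = cong (λ m → W m xor W j) (ℕ.m∸[m∸n]≡n i≤r)
        x : rowᶻ i xor colᶻ j ≡ X i xor X j
        x = trans (sym (A.ζ-even (config X) (config Y) Z T j (i ∸ j) (r ∸ i) sz))
          (A.ζ-between (config X) (config Y) Z T {cell c₁ j (i ∸ j) (r ∸ i)} (A.ok sz) inside-cell _
            (r-r-i X) (trans (r-r-i Y) (sym flip)))

      module _ (W : ℕ → Bool) (coupledᵂ : ∀ {i j} → j ≤ i → i ≤ r → X i ≢ Y i → X j ≢ Y j → rowᶻ i xor colᶻ j ≡ W i xor W j)
               (W-between : ∀ {i} → X i ≡ Y i → X i ≡ W i) {i₀ : ℕ} (i₀≤r : i₀ ≤ r) (i₀∈D : X i₀ ≢ Y i₀)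
               (row₀ : rowᶻ i₀ ≡ W i₀) where

        -- Here `W` is either of the two strings, namely one that agrees with the row of `Z` at a
        -- differing bit `i₀`. The couplings spread this agreement to all tracks.
        row⇒col : ∀ {i j} → j ≤ i → i ≤ r → X i ≢ Y i → X j ≢ Y j → rowᶻ i ≡ W i → colᶻ j ≡ W j
        row⇒col {i} {j} j≤i i≤r i∈D j∈D eq =
          xor-cancelˡ (W i) (trans (cong (_xor colᶻ j) (sym eq)) (coupledᵂ j≤i i≤r i∈D j∈D))

        col⇒row : ∀ {i j} → j ≤ i → i ≤ r → X i ≢ Y i → X j ≢ Y j → colᶻ j ≡ W j → rowᶻ i ≡ W i
        col⇒row {i} {j} j≤i i≤r i∈D j∈D eq =
          xor-cancelʳ (W j) (trans (cong (rowᶻ i xor_) (sym eq)) (coupledᵂ j≤i i≤r i∈D j∈D))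

        -- Cells exist only for columns up to the diagonal. A bit before `i₀` is reached through row
        -- `i₀` and the column of that bit; a later one through the diagonal cell of `i₀`, its
        -- column, and the row of the later bit. A diagonal cell then settles the remaining track.
        both : ∀ {i} → i ≤ r → rowᶻ i ≡ W i × colᶻ i ≡ W i
        both {i} i≤r with X i Bool.≟ Y i
        ... | yes x≡y = trans (row-between i≤r (X i) refl (sym x≡y)) (W-between x≡y)
                      , trans (col-between i≤r (X i) refl (sym x≡y)) (W-between x≡y)
        ... | no i∈D with ℕ.≤-total i i₀
        ...   | inj₁ i≤i₀ = col⇒row ℕ.≤-refl i≤r i∈D i∈D c , c
          where c = row⇒col i≤i₀ i₀≤r i₀∈D i∈D row₀
        ...   | inj₂ i₀≤i = ρ , row⇒col ℕ.≤-refl i≤r i∈D i∈D ρ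
          where ρ = col⇒row i₀≤i i≤r i∈D i₀∈D (row⇒col ℕ.≤-refl i₀≤r i₀∈D i₀∈D row₀)

        row-W : ∀ e → e ≤ r → ζ (row e) ≡ W (r ∸ e)
        row-W e e≤r = trans (cong (λ m → ζ (row m)) (sym (ℕ.m∸[m∸n]≡n e≤r))) (proj₁ (both (ℕ.m∸n≤m r e)))

        track-W : ∀ v → size v ≡ r → Inside v → ζ (track v) ≡ config W (track v)
        track-W (rP i e) sz _ = row-W e (subst (e ≤_) sz (ℕ.m≤n+m e i))
        track-W (rQ i e) sz _ = row-W e (subst (e ≤_) sz (ℕ.m≤n+m e i))
        track-W (cP i e) sz _ = proj₂ (both (subst (i ≤_) sz (ℕ.m≤m+n i e)))
        track-W (cQ i e) sz _ = proj₂ (both (subst (i ≤_) sz (ℕ.m≤m+n i e)))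
        track-W (cell p j d e) sz _ = track-cell (λ t → ζ t ≡ config W t) j d e rw cl
          (trans (A.ζ-even (config X) (config Y) Z T j d e sz) (cong₂ _xor_ rw cl)) p
          where
          rw = row-W e (subst (e ≤_) sz (ℕ.m≤n+m e (j + d)))
          cl = proj₂ (both (subst (j ≤_) sz (ℕ.≤-trans (ℕ.m≤m+n j d) (ℕ.m≤m+n (j + d) e))))

        agreeᵂ : Agree (adj (config W)) Z
        agreeᵂ = A.agree (config X) (config Y) Z T (config W) (λ v okv → track-W v (A.Ok.size≡r okv))

      agree-either : ∀ {i₀} → i₀ ≤ r → X i₀ ≢ Y i₀ → Agree (adj (config X)) Z ⊎ Agree (adj (config Y)) Z
      agree-either {i₀} i₀≤r i₀∈D = ⊎.map
        (agreeᵂ X (λ a b c d → proj₁ (coupled a b c d)) (λ _ → refl) i₀≤r i₀∈D)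
        (agreeᵂ Y (λ a b c d → proj₂ (coupled a b c d)) (λ eq → eq) i₀≤r i₀∈D)
        -- The two strings differ at `i₀`, so the row mode of `Z` there matches one of them, which
        -- then serves as `W`.
        (either i₀∈D)

    trees-adjacent : ∀ X Y {i} → i ≤ r → X i ≢ Y i → Adjacent k (extend (adj (config X))) (extend (adj (config Y)))
    trees-adjacent X Y {i} i≤r X≢Y = extend-adjacent (adj-symmetric (config X)) (adj-symmetric (config Y))
      ( code (rP i (r ∸ i)) , code (rQ i (r ∸ i)) , code<N (rP i (r ∸ i)) (row-size i≤r) , code<N (rQ i (r ∸ i)) (row-size i≤r)
      -- The code of `rQ` is one more than that of `rP`.
      , ℕ.m≢1+m+n _ ∘ (λ eq → trans eq (cong suc (sym (ℕ.+-identityʳ _))))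
      , λ eq → X≢Y (trans (sym (adj-cap X i≤r)) (trans eq (adj-cap Y i≤r))))
      (λ Z T → agree-either X Y Z T i≤r X≢Y)

    X-tree : ∀ X → IsDCTree k (extend (adj (config X)))
    X-tree X = extend-tree (adj-spine (config X) (config-even X) k′ n N*K≤n)

    truth : Fin 2 → Bool
    truth Fin.zero    = false
    truth (Fin.suc _) = true

    truth-injective : ∀ {a b} → truth a ≡ truth b → a ≡ b
    truth-injective {Fin.zero}         {Fin.zero}         _ = refl
    truth-injective {Fin.suc Fin.zero} {Fin.suc Fin.zero} _ = refl

    bits : Fin (2 ^ suc r) → ℕ → Bool
    bits m i with i ℕ.<? suc r
    ... | yes i<R = truth (finToFun {2} {suc r} m (fromℕ< i<R))
    ... | no _    = false

    bits-toℕ : ∀ m i → bits m (toℕ i) ≡ truth (finToFun {2} {suc r} m i)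
    bits-toℕ m i with toℕ i ℕ.<? suc r
    ... | yes i<R = cong (λ j → truth (finToFun {2} {suc r} m j)) (fromℕ<-toℕ i i<R)
    ... | no i≮R  = ⊥-elim (i≮R (toℕ<n i))

    bits-distinct : ∀ {m m′} → m ≢ m′ → ∃ λ i → i ≤ r × bits m i ≢ bits m′ i
    bits-distinct {m} {m′} m≢m′
      with ¬∀⟶∃¬ (suc r) (λ i → finToFun {2} {suc r} m i ≡ finToFun m′ i) (λ i → finToFun m i Fin.≟ finToFun m′ i) differ
      where
      funToFin-cong : ∀ {a b} {f g : Fin a → Fin b} → (∀ i → f i ≡ g i) → funToFin f ≡ funToFin g
      funToFin-cong {zero}  f≡g = refl
      funToFin-cong {suc a} f≡g = cong₂ combine (f≡g Fin.zero) (funToFin-cong (λ i → f≡g (Fin.suc i)))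
      differ : ¬ (∀ i → finToFun {2} {suc r} m i ≡ finToFun m′ i)
      differ same = m≢m′ (trans (sym (funToFin-finToFin {suc r} {2} m)) (trans (funToFin-cong same) (funToFin-finToFin {suc r} {2} m′)))
    ... | i , ne = toℕ i , ℕ.≤-pred (toℕ<n i)
                 , λ eq → ne (truth-injective (trans (sym (bits-toℕ m i)) (trans eq (bits-toℕ m′ i))))

    clique : IsClique k (2 ^ suc r) (λ m → extend (adj (config (bits m))))
    clique = (λ m → X-tree (bits m)) , λ m m′ m≢m′ → let (i , i≤r , ne) = bits-distinct m≢m′ in
      trees-adjacent (bits m) (bits m′) i≤r ne

-- The numerical bound and the choice of the number of bits

offset-closed : ∀ i → offset i ≡ 2 + 12 * i + 8 * (i * i)
offset-closed zero    = refl
offset-closed (suc i) rewrite offset-closed i = identity i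
  where
  identity : ∀ i → suc i * 16 + (4 + (2 + 12 * i + 8 * (i * i))) ≡ 2 + 12 * suc i + 8 * (suc i * suc i)
  identity = solve-∀

offset-bound : ∀ R → offset (suc R) ≤ (2 * R + 9) ^ 2 * 2
offset-bound R rewrite offset-closed (suc R) =
  -- The two sides are 8R² + 28R + 22 and 8R² + 72R + 162; `140 + 44 * R` is their difference.
  ℕ.≤-trans (ℕ.m≤m+n _ (140 + 44 * R)) (ℕ.≤-reflexive (identity R))
  where
  identity : ∀ R → 2 + 12 * suc R + 8 * (suc R * suc R) + (140 + 44 * R) ≡ (2 * R + 9) * ((2 * R + 9) * 1) * 2
  identity = solve-∀

-- The claim amounts to p ≤ 2Rq. If p were larger, then (p + 9q)² would be at least (2R + 9)² q²,
-- whereas `offset-bound` gives a ≤ (2R + 9)².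
at-least-bound : ∀ R s → s < offset (suc R) → AtLeastBound (2 ^ R) ((s ∸ 1) / 2)
at-least-bound R s s< = ℕ.m^n>0 2 R , exponent
  where
  a = (s ∸ 1) / 2
  a≤ : a ≤ (2 * R + 9) ^ 2
  a≤ = ℕ.*-cancelʳ-≤ a _ 2 (ℕ.≤-trans (m/n*n≤m (s ∸ 1) 2) (ℕ.≤-trans (ℕ.m∸n≤m s 1) (ℕ.≤-trans (ℕ.<⇒≤ s<) (offset-bound R))))
  square : ∀ R q → (R * (2 * q) + 9 * q) * ((R * (2 * q) + 9 * q) * 1) ≡ (2 * R + 9) * ((2 * R + 9) * 1) * (q * (q * 1))
  square = solve-∀
  exponent : ∀ p q → 1 ≤ q → (p + 9 * q) ^ 2 < a * q ^ 2 → 2 ^ p ≤ (2 ^ R) ^ (2 * q)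
  exponent p q _ lt with p ℕ.≤? R * (2 * q)
  ... | yes p≤ = subst (2 ^ p ≤_) (sym (ℕ.^-*-assoc 2 R (2 * q))) (ℕ.^-monoʳ-≤ 2 p≤)
  ... | no p≰ = ⊥-elim (ℕ.<-irrefl refl (ℕ.<-≤-trans lt (ℕ.≤-trans (ℕ.*-monoˡ-≤ (q ^ 2) a≤)
          (subst (_≤ (p + 9 * q) ^ 2) (square R q) (ℕ.^-monoˡ-≤ 2 (ℕ.+-monoˡ-≤ (9 * q) (ℕ.<⇒≤ (ℕ.≰⇒> p≰))))))))

i<offset : ∀ i → i < offset i
i<offset zero    = s≤s z≤n
i<offset (suc i) = ℕ.≤-<-trans (i<offset i) (offset-<-suc i)

i<offset-suc : ∀ i → i < offset (suc i)
i<offset-suc i = ℕ.<-trans (i<offset i) (offset-<-suc i)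

-- The largest number R of bits whose spine of `offset R` vertices fits into `s`. That one more bit
-- does not fit is what bounds `s` from above in `at-least-bound`.
largest : ∀ s t → s < offset (suc t) → ∃ λ R → s < offset (suc R) × (R ≡ 0 ⊎ offset R ≤ s)
largest s zero    s< = 0 , s< , inj₁ refl
largest s (suc t) s< with offset (suc t) ℕ.≤? s
... | yes fits = suc t , s< , inj₂ fits
... | no ¬fits = largest s t (ℕ.≰⇒> ¬fits)

-- One bit already needs `offset 1`, that is 22, spine vertices. Below that, a single tree over a
-- one-vertex spine suffices.
module Trivial (k′ n : ℕ) (K≤n : 1 * suc k′ ≤ n) where
  open Extend 1 k′ n K≤n

  point : ℕ → ℕ → Bool
  point _ _ = false

  point-spine : Spine point
  point-spine = record
    { symmetric  = λ _ _ → refl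
    ; nbrs       = λ _ → []
    ; nbrs-all   = λ _ _ _ ()
    ; nbrs-≤2    = λ _ → z≤n
    ; nbrs₀-≤1   = z≤n
    ; rank       = λ _ → 0
    ; bound      = 1
    ; rank<bound = λ _ → s≤s z≤n
    ; distinct   = λ _ _ _ ()
    ; unique     = λ _ _ _ _ _ ()
    ; lower      = λ { (s≤s z≤n) → inj₁ refl }
    }

  clique : IsClique k 1 (λ _ → extend point)
  clique = (λ _ → extend-tree point-spine) , λ { Fin.zero Fin.zero 0≢0 → ⊥-elim (0≢0 refl) }

theorem9 : (n k : ℕ) → 2 < n → (hk : 1 < k) → k < n →
    Σ ℕ λ m → Σ (Fin m → Graph n) λ T →
    IsClique k m T × AtLeastBound m ((sVal n k hk ∸ 1) / 2)
theorem9 n (suc zero) _ (s≤s ())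
theorem9 n k@(suc (suc k′)) 2<n hk k<n
  with largest (sVal n k hk) (sVal n k hk) (i<offset-suc (sVal n k hk))
... | zero , s< , _ =
  1 , _
  , Trivial.clique k′ n (ℕ.≤-trans (ℕ.≤-reflexive (ℕ.*-identityˡ (suc k′))) (ℕ.≤-trans (ℕ.n≤1+n _) (ℕ.<⇒≤ k<n)))
  , at-least-bound 0 _ s<
... | suc r , s< , inj₂ fits =
  2 ^ suc r , _
  , Family.clique r k′ n
      -- Each of the `offset (suc r)` spine vertices takes k - 1 vertices including its leaves, and
      -- s · (k - 1) ≤ n - 2.
      (ℕ.≤-trans (ℕ.*-monoˡ-≤ (suc k′) fits) (ℕ.≤-trans (m/n*n≤m (n ∸ 2) (suc k′)) (ℕ.m∸n≤m n 2)))
  , at-least-bound (suc r) _ s<
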